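{- Let $n,m$ be positive integers with $n>2m$, and write $m=2^a3^bM$ and $n-2m=2^p3^qN$ with $a,b,p,q\ge 0$ integers and $M,N$ positive integers coprime to $6$. If $f(x)=x^n-x^m-1$ is reducible over $\mathbb{Q}$, then $q>b$, $e(m)>e(n-2m)$, and $f(x)$ is divisible by $\Phi_6(x^{\gcd(n,m)})$.
   Context: For a positive integer $r$, $e(r)$ denotes the largest power of $2$ dividing $r$ (so if $r=2^{c}r_1$ with $r_1$ odd then $e(r)=2^c$). $\Phi_6(x)=x^2-x+1$ is the $6$th cyclotomic polynomial. -}

module Defs where

open import Data.Nat as ℕ using (ℕ; zero; suc; _≟_)
open import Data.Nat.DivMod using (_/_; _%_)
open import Data.Rational as ℚ using (ℚ; 0ℚ; 1ℚ)
open import Data.List using (List; []; _∷_; replicate; _++_)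
open import Data.Product using (Σ; _×_; ∃)
open import Relation.Binary.PropositionalEquality using (_≡_; _≢_)
open import Relation.Nullary using (yes; no)

-- e(r): the largest power of 2 dividing r (for r > 0).
-- Computed by repeatedly halving while even; fuel r suffices.

e-go : ℕ → ℕ → ℕ
e-go zero    r = 1
e-go (suc f) r with r % 2 ≟ 0 | r ≟ 0
... | yes _ | no _ = 2 ℕ.* e-go f (r / 2)
... | _     | _    = 1

e : ℕ → ℕ
e r = e-go r r

-- Polynomials over ℚ as coefficient lists (lowest degree first).
-- Equality of polynomials is equality of all coefficients, so trailing
-- zeros do not matter.

Poly : Set
Poly = List ℚ

coeff : Poly → ℕ → ℚ
coeff []      _       = 0ℚ
coeff (a ∷ p) zero    = a
coeff (a ∷ p) (suc k) = coeff p k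

_⊕_ : Poly → Poly → Poly
[]      ⊕ q       = q
(a ∷ p) ⊕ []      = a ∷ p
(a ∷ p) ⊕ (b ∷ q) = (a ℚ.+ b) ∷ (p ⊕ q)

scale : ℚ → Poly → Poly
scale c []      = []
scale c (a ∷ p) = (c ℚ.* a) ∷ scale c p

_⊗_ : Poly → Poly → Poly
[]      ⊗ q = []
(a ∷ p) ⊗ q = scale a q ⊕ (0ℚ ∷ (p ⊗ q))

infixl 6 _⊕_
infixl 7 _⊗_
infix 4 _≈ₚ_

_≈ₚ_ : Poly → Poly → Set
p ≈ₚ q = ∀ k → coeff p k ≡ coeff q k

mono : ℚ → ℕ → Poly
mono c k = replicate k 0ℚ ++ (c ∷ [])

NonConstant : Poly → Set
NonConstant p = Σ ℕ λ k → (1 ℕ.≤ k) × (coeff p k ≢ 0ℚ)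

-- p is reducible over ℚ: a product of two non-constant polynomials
-- (for a non-constant p, this is exactly "p is not irreducible in ℚ[x]")
Reducible : Poly → Set
Reducible p = Σ Poly λ g → Σ Poly λ h → NonConstant g × NonConstant h × (g ⊗ h ≈ₚ p)

_∣ₚ_ : Poly → Poly → Set
d ∣ₚ p = Σ Poly λ h → d ⊗ h ≈ₚ p

trinomial : ℕ → ℕ → Poly
trinomial n m = mono 1ℚ n ⊕ mono (ℚ.- 1ℚ) m ⊕ mono (ℚ.- 1ℚ) 0

Φ₆-pow : ℕ → Poly
Φ₆-pow g = mono 1ℚ (2 ℕ.* g) ⊕ mono (ℚ.- 1ℚ) g ⊕ mono 1ℚ 0

{-# OPTIONS --safe #-}
module Submission where

-- Ljunggren's argument. If f = g h with g, h ∈ ℤ[x] (Gauss's lemma), then F = g h*, where * reverses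
-- the coefficients, satisfies F F* = f f*. The middle coefficient says that the squares of the coefficients
-- of F sum to 3, and the extreme and the m-th coefficient then force F = ±f or F = ±f*. So h or g divides
-- both f and f*. Modulo such a common divisor, X = x^m and K = x^(n-2m) satisfy X²K = X + 1 and XK + X²K = 1,
-- whence K = -1 and X² + X + 1 = 0. With d = gcd n m, m = d m′ and n - 2m = d k′, the relation X^k′ = K^m′
-- gives 2 ∣ m′ and 3 ∣ k′. As m′ and k′ are coprime, this yields all three conclusions.

open import Defs
open import Algebra.Bundles using (CommutativeRing)
import Algebra.Properties.Ring as RingProperties
import Algebra.Properties.Semiring.Exp as Exp
import Algebra.Solver.Ring.NaturalCoefficients.Default as SemiringSolver
open import Data.Empty using (⊥-elim)
open import Data.Integer as ℤ using (ℤ; +_; -[1+_]; +0)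
import Data.Integer.Divisibility.Signed as ℤ-Signed
import Data.Integer.Properties as ℤₚ
open import Data.List using (List; []; _∷_)
open import Data.List.Relation.Unary.All using (All; []; _∷_)
open import Data.Nat as ℕ using (ℕ; zero; suc; s≤s; z≤n)
open import Data.Nat.Coprimality using (Coprime)
open import Data.Nat.Divisibility
  using (_∣_; _∣?_; divides; ∣1⇒≡1; ∣m∣n⇒∣m+n; ∣m+n∣m⇒∣n; m∣m*n; ∣m⇒∣m*n;
         *-pres-∣; *-monoˡ-∣; *-cancelʳ-∣; m%n≡0⇒n∣m)
open import Data.Nat.DivMod using (_%_; _/_; m≡m%n+[m/n]*n; m%n<n; m*n%n≡0; m*n/n≡m)
open import Data.Nat.GCD using (gcd; gcd[m,n]∣m; gcd[m,n]∣n; gcd-greatest; gcd[m,n]≢0)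
open import Data.Nat.ListAction using (product)
open import Data.Nat.Primality using (Prime; euclidsLemma; ¬prime[1]; prime[2]; prime?; prime⇒nonZero)
open import Data.Nat.Primality.Factorisation using (PrimeFactorisation; factorise)
import Data.Nat.Properties as ℕₚ
open import Data.Product using (∃; _×_; _,_; proj₁; proj₂)
open import Data.Rational as ℚ using (ℚ; mkℚ; 0ℚ; 1ℚ)
import Data.Rational.Properties as ℚₚ
open import Data.Rational.Unnormalised as ℚᵘ using (mkℚᵘ; *≡*)
import Data.Rational.Unnormalised.Properties as ℚᵘₚ
open import Data.Sum as Sum using (_⊎_; inj₁; inj₂)
open import Function using (_∘_)
open import Level using (_⊔_; 0ℓ)
open import Relation.Binary.Bundles using (Setoid)
open import Relation.Binary.Definitions using (tri<; tri≈; tri>)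
open import Relation.Binary.PropositionalEquality as ≡ using (_≡_; _≢_)
import Relation.Binary.Reasoning.Setoid as SetoidReasoning
open import Relation.Binary.Structures using (IsEquivalence)
open import Relation.Nullary using (¬_; Dec; yes; no)
open import Relation.Nullary.Decidable using (from-yes; from-no)

-- Third and sixth roots of unity in a commutative ring

-- Exchanging a factor for its reversal leaves F F* unchanged. Since F* lists the coefficients of F
-- backwards, the n-th coefficient of F F* is their sum of squares; for f it is 1 + 1 + 1. Over the
-- integers this leaves room for exactly three nonzero coefficients, each ±1, and two of the places
-- are 0 and n. The m-th coefficient finds the third place at m or at n - m, and n > 2m is what
-- separates these two places.
--
-- A common root of f and f* would then be natural, but no splitting field is built: the computation
-- runs in ℚ[x]/(u), with u the common divisor. This ring may have zero divisors, so no factor is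
-- cancelled unless it is visibly a unit. Nontriviality enters only as 2 ≠ 0 and 3 ≠ 0, which hold
-- because u is nonconstant: 3 ≠ 0 tells a root of t² + t + 1 from 1, and 2 ≠ 0 tells -1 from 1.

module RingLemmas {c ℓ} (R : CommutativeRing c ℓ) where
  open CommutativeRing R
  open Exp semiring
  open SetoidReasoning setoid
  open SemiringSolver commutativeSemiring
  open RingProperties ring using (+-cancelʳ)

  absorb : ∀ x {y} → y ≈ 0# → x + y ≈ x
  absorb x y≈0 = trans (+-congˡ y≈0) (+-identityʳ x)

  vanish : ∀ x {y} → y ≈ 0# → x * y ≈ 0#
  vanish x y≈0 = trans (*-congˡ y≈0) (zeroʳ x)

  x-y+z≈0⇒x+z≈y : ∀ {x y z} → x + - y + z ≈ 0# → x + z ≈ y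
  x-y+z≈0⇒x+z≈y {x} {y} {z} h = begin
    x + z                ≈⟨ absorb _ (-‿inverseˡ y) ⟨
    x + z + (- y + y)    ≈⟨ solve 4 (λ x z y′ y → x :+ z :+ (y′ :+ y) := y :+ (x :+ y′ :+ z)) refl x z (- y) y ⟩
    y + (x + - y + z)    ≈⟨ absorb y h ⟩
    y                    ∎

  x-y-z≈0⇒x≈y+z : ∀ {x y z} → x + - y + - z ≈ 0# → x ≈ y + z
  x-y-z≈0⇒x≈y+z {x} {y} {z} h = begin
    x                          ≈⟨ absorb x (-‿inverseˡ z) ⟨
    x + (- z + z)              ≈⟨ +-assoc x (- z) z ⟨
    x + - z + z                ≈⟨ +-congʳ (x-y+z≈0⇒x+z≈y h) ⟩
    y + z                      ∎

  x≈y+z⇒x-y-z≈0 : ∀ {x y z} → x ≈ y + z → x + - y + - z ≈ 0#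
  x≈y+z⇒x-y-z≈0 {x} {y} {z} h = begin
    x + - y + - z              ≈⟨ +-congʳ (+-congʳ h) ⟩
    y + z + - y + - z
      ≈⟨ solve 4 (λ y z y′ z′ → y :+ z :+ y′ :+ z′ := y :+ y′ :+ (z :+ z′)) refl y z (- y) (- z) ⟩
    y + - y + (z + - z)        ≈⟨ absorb _ (-‿inverseʳ z) ⟩
    y + - y                    ≈⟨ -‿inverseʳ y ⟩
    0#                         ∎

  1^n≈1 : ∀ n → 1# ^ n ≈ 1#
  1^n≈1 zero    = refl
  1^n≈1 (suc n) = trans (*-identityˡ _) (1^n≈1 n)

  ^-% : ∀ y t .{{_ : ℕ.NonZero t}} → y ^ t ≈ 1# → ∀ n → y ^ n ≈ y ^ (n % t)
  ^-% y t yᵗ≈1 n = begin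
    y ^ n                            ≡⟨ ≡.cong (y ^_) (m≡m%n+[m/n]*n n t) ⟩
    y ^ (n % t ℕ.+ n / t ℕ.* t)      ≈⟨ ^-homo-* y (n % t) _ ⟩
    y ^ (n % t) * y ^ (n / t ℕ.* t)  ≡⟨ ≡.cong (λ j → y ^ (n % t) * y ^ j) (ℕₚ.*-comm (n / t) t) ⟩
    y ^ (n % t) * y ^ (t ℕ.* (n / t)) ≈⟨ *-congˡ (^-assocʳ y t (n / t)) ⟨
    y ^ (n % t) * (y ^ t) ^ (n / t)  ≈⟨ *-congˡ (trans (^-congˡ (n / t) yᵗ≈1) (1^n≈1 (n / t))) ⟩
    y ^ (n % t) * 1#                 ≈⟨ *-identityʳ _ ⟩
    y ^ (n % t)                      ∎

  -- The factorisation of `X ^ 3 - 1` without subtraction: a zero is added on one side, and after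
  -- regrouping a multiple of it is dropped on the other. The computations with roots below follow
  -- this pattern.
  ω-cubed : ∀ {X} → X * X + X + 1# ≈ 0# → X ^ 3 ≈ 1#
  ω-cubed {X} h = begin
    X ^ 3                      ≈⟨ absorb _ h ⟨
    X ^ 3 + (X * X + X + 1#)
      ≈⟨ solve 1 (λ X → X :^ 3 :+ (X :* X :+ X :+ con 1) := con 1 :+ X :* (X :* X :+ X :+ con 1)) refl X ⟩
    1# + X * (X * X + X + 1#)  ≈⟨ absorb _ (vanish X h) ⟩
    1#                         ∎

  -1-squared : ∀ {K} → K + 1# ≈ 0# → K ^ 2 ≈ 1#
  -1-squared {K} h = begin
    K ^ 2              ≈⟨ absorb _ h ⟨
    K ^ 2 + (K + 1#)   ≈⟨ solve 1 (λ K → K :^ 2 :+ (K :+ con 1) := con 1 :+ K :* (K :+ con 1)) refl K ⟩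
    1# + K * (K + 1#)  ≈⟨ absorb _ (vanish K h) ⟩
    1#                 ∎

  -- Here and below, K = -1 is written K + 1# ≈ 0#, so that only semiring identities are needed.
  common-root : ∀ {X K} → X * X * K ≈ X + 1# → X * K + X * X * K ≈ 1# →
                (K + 1# ≈ 0#) × (X * X + X + 1# ≈ 0#)
  common-root {X} {K} f f* = K+1≈0 , (begin
    X * X + X + 1#      ≈⟨ +-assoc _ _ _ ⟩
    X * X + (X + 1#)    ≈⟨ +-congˡ f ⟨
    X * X + X * X * K   ≈⟨ solve 2 (λ X K → X :* X :+ X :* X :* K := X :* X :* (K :+ con 1)) refl X K ⟩
    X * X * (K + 1#)    ≈⟨ vanish _ K+1≈0 ⟩
    0#                  ∎)
    where
    -- Eliminating `X * X * K` between the two relations leaves X (K + 1) = 0.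
    XK+X≈0 : X * K + X ≈ 0#
    XK+X≈0 = +-cancelʳ 1# _ _ (begin
      X * K + X + 1#      ≈⟨ +-assoc _ _ _ ⟩
      X * K + (X + 1#)    ≈⟨ +-congˡ f ⟨
      X * K + X * X * K   ≈⟨ f* ⟩
      1#                  ≈⟨ +-identityˡ 1# ⟨
      0# + 1#             ∎)
    -- `X` may not simply be cancelled from X (K + 1) = 0. But `f*` reads X K (1 + X) = 1, so `X` is
    -- a unit, and multiplying by this expression for 1 does the cancelling.
    K+1≈0 : K + 1# ≈ 0#
    K+1≈0 = begin
      K + 1#                            ≈⟨ *-identityʳ _ ⟨
      (K + 1#) * 1#                     ≈⟨ *-congˡ f* ⟨
      (K + 1#) * (X * K + X * X * K)
        ≈⟨ solve 2 (λ X K → (K :+ con 1) :* (X :* K :+ X :* X :* K) := (K :+ X :* K) :* (X :* K :+ X)) refl X K ⟩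
      (K + X * K) * (X * K + X)         ≈⟨ vanish _ XK+X≈0 ⟩
      0#                                ∎

  -- Squaring removes the sign `K ^ m`, so the exponent 2k of `X` gives 1. As X³ = 1 and 2 is prime
  -- to 3, a nonzero residue of `k` modulo 3 would force X = 1, hence 3 = 0. Now `X ^ k` is 1, and
  -- an odd `m` would give 1 = -1.
  orders : ∀ {X K} m k → K + 1# ≈ 0# → X * X + X + 1# ≈ 0# → X ^ k ≈ K ^ m →
           ¬ (1# + 1# ≈ 0#) → ¬ (1# + 1# + 1# ≈ 0#) → (2 ∣ m) × (3 ∣ k)
  orders {X} {K} m k K≈-1 X-root Xᵏ≈Kᵐ 2≉0 3≉0 = m%n≡0⇒n∣m m 2 (m%2≡0 (m%n<n m 2) residues) , m%n≡0⇒n∣m k 3 k%3≡0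
    where
    residues : X ^ (k % 3) ≈ K ^ (m % 2)
    residues = trans (sym (^-% X 3 (ω-cubed X-root) k)) (trans Xᵏ≈Kᵐ (^-% K 2 (-1-squared K≈-1) m))

    X≉1 : ¬ (X ≈ 1#)
    X≉1 X≈1 = 3≉0 (trans (sym (+-congʳ (+-cong (trans (*-cong X≈1 X≈1) (*-identityˡ 1#)) X≈1))) X-root)

    square : X ^ (k % 3) * X ^ (k % 3) ≈ 1#
    square = begin
      X ^ (k % 3) * X ^ (k % 3)  ≈⟨ *-cong residues residues ⟩
      K ^ (m % 2) * K ^ (m % 2)  ≈⟨ ^-homo-* K (m % 2) (m % 2) ⟨
      K ^ (m % 2 ℕ.+ m % 2)      ≡⟨ ≡.cong (K ^_) (≡.cong (m % 2 ℕ.+_) (≡.sym (ℕₚ.+-identityʳ (m % 2)))) ⟩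
      K ^ (2 ℕ.* (m % 2))        ≈⟨ ^-assocʳ K 2 (m % 2) ⟨
      (K ^ 2) ^ (m % 2)          ≈⟨ ^-congˡ (m % 2) (-1-squared K≈-1) ⟩
      1# ^ (m % 2)               ≈⟨ 1^n≈1 (m % 2) ⟩
      1#                         ∎

    small : ∀ {s} → s ℕ.< 3 → X ^ s * X ^ s ≈ 1# → s ≡ 0
    small {0} _ _ = ≡.refl
    small {1} _ h = ⊥-elim (X≉1 (begin
      X                      ≈⟨ *-identityʳ X ⟨
      X * 1#                 ≈⟨ *-congˡ h ⟨
      X * (X ^ 1 * X ^ 1)    ≈⟨ solve 1 (λ X → X :* (X :^ 1 :* X :^ 1) := X :^ 3) refl X ⟩
      X ^ 3                  ≈⟨ ω-cubed X-root ⟩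
      1#                     ∎))
    small {2} _ h = ⊥-elim (X≉1 (begin
      X                      ≈⟨ *-identityʳ X ⟨
      X * 1#                 ≈⟨ *-congˡ (ω-cubed X-root) ⟨
      X * X ^ 3              ≈⟨ solve 1 (λ X → X :* X :^ 3 := X :^ 2 :* X :^ 2) refl X ⟩
      X ^ 2 * X ^ 2          ≈⟨ h ⟩
      1#                     ∎))
    small {suc (suc (suc _))} (s≤s (s≤s (s≤s ()))) _

    k%3≡0 : k % 3 ≡ 0
    k%3≡0 = small (m%n<n k 3) square

    m%2≡0 : ∀ {r} → r ℕ.< 2 → X ^ (k % 3) ≈ K ^ r → r ≡ 0
    m%2≡0 {0} _ _ = ≡.refl
    m%2≡0 {1} _ h = ⊥-elim (2≉0 (begin
      1# + 1#            ≡⟨ ≡.cong (λ s → X ^ s + 1#) k%3≡0 ⟨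
      X ^ (k % 3) + 1#   ≈⟨ +-congʳ h ⟩
      K ^ 1 + 1#         ≈⟨ +-congʳ (*-identityʳ K) ⟩
      K + 1#             ≈⟨ K≈-1 ⟩
      0#                 ∎))
    m%2≡0 {suc (suc _)} (s≤s (s≤s ())) _

  -- Here y³ = -1, so y^k = -1 for an odd multiple `k` of 3. Moreover W = y² is a root of t² + t +
  -- 1, and so is Z = W^l when 3 does not divide l. The claim follows from Z² K - Z - 1 = Z² (K + 1)
  -- - (Z² + Z + 1), with K = y^k.
  sixth-root : ∀ {y} m k → y * y + 1# ≈ y → 2 ∣ m → ¬ (3 ∣ m) → 3 ∣ k → ¬ (2 ∣ k) →
               y ^ (m ℕ.+ m ℕ.+ k) ≈ y ^ m + 1#
  sixth-root {y} m k Φ₆ 2∣m@(divides l m≡) 3∤m (divides j k≡) 2∤k = begin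
    y ^ (m ℕ.+ m ℕ.+ k)       ≈⟨ ^-homo-* y (m ℕ.+ m) k ⟩
    y ^ (m ℕ.+ m) * y ^ k     ≈⟨ *-congʳ (^-homo-* y m m) ⟩
    Z * Z * y ^ k             ≈⟨ absorb _ Z-root ⟨
    Z * Z * y ^ k + (Z * Z + Z + 1#)
      ≈⟨ solve 2 (λ Z K → Z :* Z :* K :+ (Z :* Z :+ Z :+ con 1) := Z :+ con 1 :+ Z :* Z :* (K :+ con 1)) refl Z (y ^ k) ⟩
    Z + 1# + Z * Z * (y ^ k + 1#)      ≈⟨ absorb _ (vanish _ yᵏ≈-1) ⟩
    Z + 1#                    ∎
    where
    Z = y ^ m
    W = y ^ 2

    y³≈-1 : y ^ 3 + 1# ≈ 0#
    y³≈-1 = +-cancelʳ y _ _ (begin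
      y ^ 3 + 1# + y
        ≈⟨ solve 1 (λ y → y :^ 3 :+ con 1 :+ y := y :* (y :* y :+ con 1) :+ con 1) refl y ⟩
      y * (y * y + 1#) + 1#   ≈⟨ +-congʳ (*-congˡ Φ₆) ⟩
      y * y + 1#              ≈⟨ Φ₆ ⟩
      y                       ≈⟨ +-identityˡ y ⟨
      0# + y                  ∎)

    W-root : W * W + W + 1# ≈ 0#
    W-root = begin
      W * W + W + 1#
        ≈⟨ solve 1 (λ y → y :^ 2 :* y :^ 2 :+ y :^ 2 :+ con 1 := y :* y :^ 3 :+ (y :* y :+ con 1)) refl y ⟩
      y * y ^ 3 + (y * y + 1#)  ≈⟨ +-congˡ Φ₆ ⟩
      y * y ^ 3 + y             ≈⟨ solve 2 (λ y z → y :* z :+ y := y :* (z :+ con 1)) refl y (y ^ 3) ⟩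
      y * (y ^ 3 + 1#)          ≈⟨ vanish y y³≈-1 ⟩
      0#                        ∎

    -- The remainder is made a variable so that it can be matched on; remainder 0 would make k = 3j
    -- even.
    odd : ∀ {r} → r ≡ j % 2 → (y ^ 3) ^ r + 1# ≈ 0#
    odd {zero} eq with m%n≡0⇒n∣m j 2 (≡.sym eq)
    ... | divides i ≡.refl = ⊥-elim (2∤k (divides (i ℕ.* 3) (≡.trans k≡
            (≡.trans (ℕₚ.*-assoc i 2 3) (≡.sym (ℕₚ.*-assoc i 3 2))))))
    odd {suc zero} eq = trans (+-congʳ (*-identityʳ (y ^ 3))) y³≈-1
    odd {suc (suc r)} eq with ≡.subst (ℕ._< 2) (≡.sym eq) (m%n<n j 2)
    ... | s≤s (s≤s ())

    yᵏ≈-1 : y ^ k + 1# ≈ 0#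
    yᵏ≈-1 = begin
      y ^ k + 1#                ≡⟨ ≡.cong (λ i → y ^ i + 1#) (≡.trans k≡ (ℕₚ.*-comm j 3)) ⟩
      y ^ (3 ℕ.* j) + 1#        ≈⟨ +-congʳ (^-assocʳ y 3 j) ⟨
      (y ^ 3) ^ j + 1#          ≈⟨ +-congʳ (^-% (y ^ 3) 2 (-1-squared y³≈-1) j) ⟩
      (y ^ 3) ^ (j % 2) + 1#    ≈⟨ odd ≡.refl ⟩
      0#                        ∎

    root : ∀ {r} → r ≡ l % 3 → W ^ r * W ^ r + W ^ r + 1# ≈ 0#
    root {zero} eq with m%n≡0⇒n∣m l 3 (≡.sym eq)
    ... | divides i ≡.refl = ⊥-elim (3∤m (divides (i ℕ.* 2) (≡.trans m≡
            (≡.trans (ℕₚ.*-assoc i 3 2) (≡.sym (ℕₚ.*-assoc i 2 3))))))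
    root {suc zero} eq = trans (solve 1 (λ W → W :^ 1 :* W :^ 1 :+ W :^ 1 :+ con 1 := W :* W :+ W :+ con 1) refl W) W-root
    root {suc (suc zero)} eq = begin
      W ^ 2 * W ^ 2 + W ^ 2 + 1#
        ≈⟨ solve 1 (λ W → W :^ 2 :* W :^ 2 :+ W :^ 2 :+ con 1 := W :* W :^ 3 :+ (W :* W :+ con 1)) refl W ⟩
      W * W ^ 3 + (W * W + 1#)    ≈⟨ +-congʳ (*-congˡ (ω-cubed W-root)) ⟩
      W * 1# + (W * W + 1#)
        ≈⟨ solve 1 (λ W → W :* con 1 :+ (W :* W :+ con 1) := W :* W :+ W :+ con 1) refl W ⟩
      W * W + W + 1#              ≈⟨ W-root ⟩
      0#                          ∎
    root {suc (suc (suc r))} eq with ≡.subst (ℕ._< 3) (≡.sym eq) (m%n<n l 3)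
    ... | s≤s (s≤s (s≤s ()))

    Z≈ : Z ≈ W ^ (l % 3)
    Z≈ = begin
      y ^ m           ≡⟨ ≡.cong (y ^_) (≡.trans m≡ (ℕₚ.*-comm l 2)) ⟩
      y ^ (2 ℕ.* l)   ≈⟨ ^-assocʳ y 2 l ⟨
      W ^ l           ≈⟨ ^-% W 3 (ω-cubed W-root) l ⟩
      W ^ (l % 3)     ∎

    Z-root : Z * Z + Z + 1# ≈ 0#
    Z-root = trans (+-congʳ (+-cong (*-cong Z≈ Z≈) Z≈)) (root ≡.refl)

-- The quotient of a commutative ring by a principal ideal

module _ {c ℓ} (R : CommutativeRing c ℓ) (u : CommutativeRing.Carrier R) where
  open CommutativeRing R
  open SetoidReasoning setoid
  open SemiringSolver commutativeSemiring
  open RingProperties ring using (-‿+-comm; -‿distribʳ-*)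

  infix 4 _≈ᵤ_
  -- The carrier stays and only the equality is coarsened. The cofactor is kept as data, so that a
  -- congruence to 0 in the polynomial ring is exactly a witness of `u ∣ₚ x`.
  record _≈ᵤ_ (x y : Carrier) : Set (c ⊔ ℓ) where
    constructor mod
    field
      factor : Carrier
      eq     : x ≈ y + u * factor

  ≈⇒≈ᵤ : ∀ {x y} → x ≈ y → x ≈ᵤ y
  ≈⇒≈ᵤ {x} {y} x≈y = mod 0# (trans x≈y (sym (trans (+-congˡ (zeroʳ u)) (+-identityʳ y))))

  private
    u-sym : ∀ {x y} → x ≈ᵤ y → y ≈ᵤ x
    u-sym {x} {y} (mod h e) = mod (- h) (begin
      y                              ≈⟨ +-identityʳ y ⟨
      y + 0#                         ≈⟨ +-congˡ (zeroʳ u) ⟨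
      y + u * 0#                     ≈⟨ +-congˡ (*-congˡ (-‿inverseʳ h)) ⟨
      y + u * (h + - h)
        ≈⟨ solve 4 (λ y u h i → y :+ u :* (h :+ i) := (y :+ u :* h) :+ u :* i) refl y u h (- h) ⟩
      y + u * h + u * - h            ≈⟨ +-congʳ e ⟨
      x + u * - h                    ∎)

    u-trans : ∀ {x y z} → x ≈ᵤ y → y ≈ᵤ z → x ≈ᵤ z
    u-trans {x} {y} {z} (mod h e) (mod i e') = mod (i + h) (begin
      x                    ≈⟨ e ⟩
      y + u * h            ≈⟨ +-congʳ e' ⟩
      z + u * i + u * h    ≈⟨ solve 4 (λ z u i h → z :+ u :* i :+ u :* h := z :+ u :* (i :+ h)) refl z u i h ⟩
      z + u * (i + h)      ∎)

    u-+-cong : ∀ {x y z w} → x ≈ᵤ y → z ≈ᵤ w → x + z ≈ᵤ y + w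
    u-+-cong {x} {y} {z} {w} (mod h e) (mod i e') = mod (h + i) (trans (+-cong e e')
      (solve 5 (λ y w u h i → y :+ u :* h :+ (w :+ u :* i) := y :+ w :+ u :* (h :+ i)) refl y w u h i))

    u-*-cong : ∀ {x y z w} → x ≈ᵤ y → z ≈ᵤ w → x * z ≈ᵤ y * w
    u-*-cong {x} {y} {z} {w} (mod h e) (mod i e') = mod (h * w + y * i + h * (u * i)) (trans (*-cong e e')
      (solve 5 (λ y w u h i → (y :+ u :* h) :* (w :+ u :* i) := y :* w :+ u :* (h :* w :+ y :* i :+ h :* (u :* i))) refl y w u h i))

    u-neg-cong : ∀ {x y} → x ≈ᵤ y → - x ≈ᵤ - y
    u-neg-cong {x} {y} (mod h e) = mod (- h) (begin
      - x              ≈⟨ -‿cong e ⟩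
      - (y + u * h)    ≈⟨ -‿+-comm y (u * h) ⟨
      - y + - (u * h)  ≈⟨ +-congˡ (-‿distribʳ-* u h) ⟩
      - y + u * - h    ∎)

  quotient : CommutativeRing c (c ⊔ ℓ)
  quotient = record
    { Carrier = Carrier ; _≈_ = _≈ᵤ_ ; _+_ = _+_ ; _*_ = _*_ ; -_ = -_ ; 0# = 0# ; 1# = 1#
    ; isCommutativeRing = record
      { isRing = record
        { +-isAbelianGroup = record
          { isGroup = record
            { isMonoid = record
              { isSemigroup = record
                { isMagma = record
                  { isEquivalence = record { refl = ≈⇒≈ᵤ refl ; sym = u-sym ; trans = u-trans }
                  ; ∙-cong = u-+-cong }
                ; assoc = λ x y z → ≈⇒≈ᵤ (+-assoc x y z) }
              ; identity = (λ x → ≈⇒≈ᵤ (+-identityˡ x)) , (λ x → ≈⇒≈ᵤ (+-identityʳ x)) }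
            ; inverse = (λ x → ≈⇒≈ᵤ (-‿inverseˡ x)) , (λ x → ≈⇒≈ᵤ (-‿inverseʳ x))
            ; ⁻¹-cong = u-neg-cong }
          ; comm = λ x y → ≈⇒≈ᵤ (+-comm x y) }
        ; *-cong = u-*-cong
        ; *-assoc = λ x y z → ≈⇒≈ᵤ (*-assoc x y z)
        ; *-identity = (λ x → ≈⇒≈ᵤ (*-identityˡ x)) , (λ x → ≈⇒≈ᵤ (*-identityʳ x))
        ; distrib = (λ x y z → ≈⇒≈ᵤ (distribˡ x y z)) , (λ x y z → ≈⇒≈ᵤ (distribʳ x y z)) }
      ; *-comm = λ x y → ≈⇒≈ᵤ (*-comm x y) } }

open ≡ using (refl; sym; trans; cong; cong₂; subst; subst₂)

-- The ring ℚ[x]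

module ℚ-Ring = CommutativeRing ℚₚ.+-*-commutativeRing
module ℚ-Props = RingProperties ℚ-Ring.ring
module ℚ-Solver = SemiringSolver ℚ-Ring.commutativeSemiring

-- A record, so that p and q can be inferred from a proof of p ≈ q.
infix 4 _≈_
record _≈_ (p q : Poly) : Set where
  constructor mk
  field at : p ≈ₚ q
open _≈_ public

≈-refl : ∀ {p} → p ≈ p
≈-refl = mk λ _ → refl
≈-sym : ∀ {p q} → p ≈ q → q ≈ p
≈-sym e = mk λ k → sym (at e k)
≈-trans : ∀ {p q r} → p ≈ q → q ≈ r → p ≈ r
≈-trans e f = mk λ k → trans (at e k) (at f k)

≈-isEquivalence : IsEquivalence _≈_
≈-isEquivalence = record { refl = ≈-refl ; sym = ≈-sym ; trans = ≈-trans }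

≈-setoid : Setoid 0ℓ 0ℓ
≈-setoid = record { isEquivalence = ≈-isEquivalence }

module PolyReasoning = SetoidReasoning ≈-setoid

coeff-⊕ : ∀ p q k → coeff (p ⊕ q) k ≡ coeff p k ℚ.+ coeff q k
coeff-⊕ []      q       k       = sym (ℚₚ.+-identityˡ _)
coeff-⊕ (a ∷ p) []      k       = sym (ℚₚ.+-identityʳ _)
coeff-⊕ (a ∷ p) (b ∷ q) zero    = refl
coeff-⊕ (a ∷ p) (b ∷ q) (suc k) = coeff-⊕ p q k

coeff-scale : ∀ c p k → coeff (scale c p) k ≡ c ℚ.* coeff p k
coeff-scale c []      k       = sym (ℚₚ.*-zeroʳ c)
coeff-scale c (a ∷ p) zero    = refl
coeff-scale c (a ∷ p) (suc k) = coeff-scale c p k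

∷-cong : ∀ {a b p q} → a ≡ b → p ≈ q → (a ∷ p) ≈ (b ∷ q)
∷-cong a≡b e = mk λ { zero → a≡b ; (suc k) → at e k }

0∷[] : (0ℚ ∷ []) ≈ []
0∷[] = mk λ { zero → refl ; (suc k) → refl }

⊕-cong : ∀ {p p' q q'} → p ≈ p' → q ≈ q' → p ⊕ q ≈ p' ⊕ q'
⊕-cong {p} {p'} {q} {q'} e f = mk λ k → trans (coeff-⊕ p q k) (trans (cong₂ ℚ._+_ (at e k) (at f k)) (sym (coeff-⊕ p' q' k)))

⊕-assoc : ∀ p q r → (p ⊕ q) ⊕ r ≈ p ⊕ (q ⊕ r)
⊕-assoc p q r = mk λ k → begin
  coeff ((p ⊕ q) ⊕ r) k                       ≡⟨ coeff-⊕ (p ⊕ q) r k ⟩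
  coeff (p ⊕ q) k ℚ.+ coeff r k               ≡⟨ cong (ℚ._+ coeff r k) (coeff-⊕ p q k) ⟩
  coeff p k ℚ.+ coeff q k ℚ.+ coeff r k       ≡⟨ ℚₚ.+-assoc (coeff p k) _ _ ⟩
  coeff p k ℚ.+ (coeff q k ℚ.+ coeff r k)     ≡⟨ cong (coeff p k ℚ.+_) (coeff-⊕ q r k) ⟨
  coeff p k ℚ.+ coeff (q ⊕ r) k               ≡⟨ coeff-⊕ p (q ⊕ r) k ⟨
  coeff (p ⊕ (q ⊕ r)) k                       ∎
  where open ≡.≡-Reasoning

⊕-comm : ∀ p q → p ⊕ q ≈ q ⊕ p
⊕-comm p q = mk λ k → trans (coeff-⊕ p q k) (trans (ℚₚ.+-comm (coeff p k) _) (sym (coeff-⊕ q p k)))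

⊕-identityʳ : ∀ p → p ⊕ [] ≈ p
⊕-identityʳ p = ⊕-comm p []

neg : Poly → Poly
neg = scale (ℚ.- 1ℚ)

coeff-neg : ∀ p k → coeff (neg p) k ≡ ℚ.- coeff p k
coeff-neg p k = trans (coeff-scale (ℚ.- 1ℚ) p k) (ℚ-Props.-1*x≈-x (coeff p k))

neg-inverseˡ : ∀ p → neg p ⊕ p ≈ []
neg-inverseˡ p = mk λ k → trans (coeff-⊕ (neg p) p k) (trans (cong (ℚ._+ coeff p k) (coeff-neg p k)) (ℚₚ.+-inverseˡ (coeff p k)))

scale-cong : ∀ {c d p q} → c ≡ d → p ≈ q → scale c p ≈ scale d q
scale-cong {c} {d} {p} {q} c≡d e = mk λ k → trans (coeff-scale c p k) (trans (cong₂ ℚ._*_ c≡d (at e k)) (sym (coeff-scale d q k)))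

scale-⊕ : ∀ c p q → scale c (p ⊕ q) ≈ scale c p ⊕ scale c q
scale-⊕ c p q = mk λ k → begin
  coeff (scale c (p ⊕ q)) k                        ≡⟨ coeff-scale c (p ⊕ q) k ⟩
  c ℚ.* coeff (p ⊕ q) k                            ≡⟨ cong (c ℚ.*_) (coeff-⊕ p q k) ⟩
  c ℚ.* (coeff p k ℚ.+ coeff q k)                  ≡⟨ ℚₚ.*-distribˡ-+ c (coeff p k) _ ⟩
  c ℚ.* coeff p k ℚ.+ c ℚ.* coeff q k              ≡⟨ cong₂ ℚ._+_ (coeff-scale c p k) (coeff-scale c q k) ⟨
  coeff (scale c p) k ℚ.+ coeff (scale c q) k      ≡⟨ coeff-⊕ (scale c p) (scale c q) k ⟨
  coeff (scale c p ⊕ scale c q) k                  ∎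
  where open ≡.≡-Reasoning

scale-+ : ∀ c d p → scale (c ℚ.+ d) p ≈ scale c p ⊕ scale d p
scale-+ c d p = mk λ k → begin
  coeff (scale (c ℚ.+ d) p) k                      ≡⟨ coeff-scale (c ℚ.+ d) p k ⟩
  (c ℚ.+ d) ℚ.* coeff p k                          ≡⟨ ℚₚ.*-distribʳ-+ (coeff p k) c d ⟩
  c ℚ.* coeff p k ℚ.+ d ℚ.* coeff p k              ≡⟨ cong₂ ℚ._+_ (coeff-scale c p k) (coeff-scale d p k) ⟨
  coeff (scale c p) k ℚ.+ coeff (scale d p) k      ≡⟨ coeff-⊕ (scale c p) (scale d p) k ⟨
  coeff (scale c p ⊕ scale d p) k                  ∎
  where open ≡.≡-Reasoning

scale-* : ∀ c d p → scale c (scale d p) ≈ scale (c ℚ.* d) p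
scale-* c d p = mk λ k → trans (coeff-scale c (scale d p) k) (trans (cong (c ℚ.*_) (coeff-scale d p k))
  (trans (sym (ℚₚ.*-assoc c d _)) (sym (coeff-scale (c ℚ.* d) p k))))

scale-zero : ∀ p → scale 0ℚ p ≈ []
scale-zero p = mk λ k → trans (coeff-scale 0ℚ p k) (ℚₚ.*-zeroˡ (coeff p k))

scale-one : ∀ p → scale 1ℚ p ≈ p
scale-one p = mk λ k → trans (coeff-scale 1ℚ p k) (ℚₚ.*-identityˡ (coeff p k))

⊕-interchange : ∀ p q r s → (p ⊕ q) ⊕ (r ⊕ s) ≈ (p ⊕ r) ⊕ (q ⊕ s)
⊕-interchange p q r s = mk λ k → begin
  coeff ((p ⊕ q) ⊕ (r ⊕ s)) k                 ≡⟨ expand p q r s k ⟩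
  coeff p k ℚ.+ coeff q k ℚ.+ (coeff r k ℚ.+ coeff s k)
    ≡⟨ solve 4 (λ a b c d → a :+ b :+ (c :+ d) := a :+ c :+ (b :+ d)) refl (coeff p k) (coeff q k) (coeff r k) (coeff s k) ⟩
  coeff p k ℚ.+ coeff r k ℚ.+ (coeff q k ℚ.+ coeff s k)  ≡⟨ expand p r q s k ⟨
  coeff ((p ⊕ r) ⊕ (q ⊕ s)) k                 ∎
  where
  open ≡.≡-Reasoning
  open ℚ-Solver
  expand : ∀ p q r s k → coeff ((p ⊕ q) ⊕ (r ⊕ s)) k ≡ coeff p k ℚ.+ coeff q k ℚ.+ (coeff r k ℚ.+ coeff s k)
  expand p q r s k = trans (coeff-⊕ (p ⊕ q) (r ⊕ s) k) (cong₂ ℚ._+_ (coeff-⊕ p q k) (coeff-⊕ r s k))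

⊗-zeroʳ : ∀ p → p ⊗ [] ≈ []
⊗-zeroʳ []      = ≈-refl
⊗-zeroʳ (a ∷ p) = ≈-trans (∷-cong refl (⊗-zeroʳ p)) 0∷[]

⊗-congʳ : ∀ p {q q'} → q ≈ q' → p ⊗ q ≈ p ⊗ q'
⊗-congʳ []      e = ≈-refl
⊗-congʳ (a ∷ p) e = ⊕-cong (scale-cong refl e) (∷-cong refl (⊗-congʳ p e))

-- The definition of `_⊗_` recurses on its left factor. This is the mirror recursion, from which
-- commutativity follows by induction.
⊗-∷ : ∀ p b q → p ⊗ (b ∷ q) ≈ scale b p ⊕ (0ℚ ∷ p ⊗ q)
⊗-∷ []      b q = ≈-sym 0∷[]
⊗-∷ (a ∷ p) b q = ∷-cong (cong (ℚ._+ 0ℚ) (ℚₚ.*-comm a b)) (begin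
  scale a q ⊕ (p ⊗ (b ∷ q))                    ≈⟨ ⊕-cong ≈-refl (⊗-∷ p b q) ⟩
  scale a q ⊕ (scale b p ⊕ (0ℚ ∷ p ⊗ q))       ≈⟨ ⊕-assoc (scale a q) _ _ ⟨
  (scale a q ⊕ scale b p) ⊕ (0ℚ ∷ p ⊗ q)       ≈⟨ ⊕-cong (⊕-comm (scale a q) _) ≈-refl ⟩
  (scale b p ⊕ scale a q) ⊕ (0ℚ ∷ p ⊗ q)       ≈⟨ ⊕-assoc (scale b p) _ _ ⟩
  scale b p ⊕ (scale a q ⊕ (0ℚ ∷ p ⊗ q))       ∎)
  where open PolyReasoning

⊗-comm : ∀ p q → p ⊗ q ≈ q ⊗ p
⊗-comm []      q = ≈-sym (⊗-zeroʳ q)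
⊗-comm (a ∷ p) q = ≈-trans (⊕-cong ≈-refl (∷-cong refl (⊗-comm p q))) (≈-sym (⊗-∷ q a p))

⊗-distribʳ : ∀ r p q → (p ⊕ q) ⊗ r ≈ p ⊗ r ⊕ q ⊗ r
⊗-distribʳ r []      q       = ≈-refl
⊗-distribʳ r (a ∷ p) []      = ≈-sym (⊕-identityʳ _)
⊗-distribʳ r (a ∷ p) (b ∷ q) = ≈-trans
  (⊕-cong (scale-+ a b r) (∷-cong refl (⊗-distribʳ r p q)))
  (⊕-interchange (scale a r) (scale b r) (0ℚ ∷ p ⊗ r) (0ℚ ∷ q ⊗ r))

scale-⊗ : ∀ c p q → scale c p ⊗ q ≈ scale c (p ⊗ q)
scale-⊗ c []      q = ≈-refl
scale-⊗ c (a ∷ p) q = ≈-trans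
  (⊕-cong (≈-sym (scale-* c a q)) (∷-cong (sym (ℚₚ.*-zeroʳ c)) (scale-⊗ c p q)))
  (≈-sym (scale-⊕ c (scale a q) (0ℚ ∷ p ⊗ q)))

0∷-⊗ : ∀ p q → (0ℚ ∷ p) ⊗ q ≈ 0ℚ ∷ p ⊗ q
0∷-⊗ p q = ⊕-cong (scale-zero q) ≈-refl

⊗-assoc : ∀ p q r → (p ⊗ q) ⊗ r ≈ p ⊗ (q ⊗ r)
⊗-assoc []      q r = ≈-refl
⊗-assoc (a ∷ p) q r = ≈-trans (⊗-distribʳ r (scale a q) (0ℚ ∷ p ⊗ q))
  (⊕-cong (scale-⊗ a q r) (≈-trans (0∷-⊗ (p ⊗ q) r) (∷-cong refl (⊗-assoc p q r))))

one : Poly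
one = 1ℚ ∷ []

⊗-identityˡ : ∀ p → one ⊗ p ≈ p
⊗-identityˡ p = ≈-trans (⊕-cong (scale-one p) 0∷[]) (⊕-identityʳ p)

-- Equal polynomials may be lists of different lengths, which obstructs a joint recursion on the
-- left factors; commutativity moves them to the right.
⊗-cong : ∀ {p p' q q'} → p ≈ p' → q ≈ q' → p ⊗ q ≈ p' ⊗ q'
⊗-cong {p} {p'} {q} {q'} e f = ≈-trans (⊗-congʳ p f)
  (≈-trans (⊗-comm p q') (≈-trans (⊗-congʳ q' e) (⊗-comm q' p')))

polyRing : CommutativeRing 0ℓ 0ℓ
polyRing = record
  { Carrier = Poly ; _≈_ = _≈_ ; _+_ = _⊕_ ; _*_ = _⊗_ ; -_ = neg ; 0# = [] ; 1# = one
  ; isCommutativeRing = record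
    { isRing = record
      { +-isAbelianGroup = record
        { isGroup = record
          { isMonoid = record
            { isSemigroup = record
              { isMagma = record
                { isEquivalence = ≈-isEquivalence
                ; ∙-cong = ⊕-cong }
              ; assoc = ⊕-assoc }
            ; identity = (λ _ → ≈-refl) , ⊕-identityʳ }
          ; inverse = neg-inverseˡ , (λ p → ≈-trans (⊕-comm p (neg p)) (neg-inverseˡ p))
          ; ⁻¹-cong = scale-cong refl }
        ; comm = ⊕-comm }
      ; *-cong = ⊗-cong
      ; *-assoc = ⊗-assoc
      ; *-identity = ⊗-identityˡ , (λ p → ≈-trans (⊗-comm p one) (⊗-identityˡ p))
      ; distrib = (λ p q r → ≈-trans (⊗-comm p (q ⊕ r)) (≈-trans (⊗-distribʳ p q r) (⊕-cong (⊗-comm q p) (⊗-comm r p)))) , ⊗-distribʳ }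
    ; *-comm = ⊗-comm } }

module ℚ[x] = CommutativeRing polyRing
module PolySolver = SemiringSolver ℚ[x].commutativeSemiring

x : Poly
x = 0ℚ ∷ 1ℚ ∷ []

x⊗ : ∀ p → x ⊗ p ≈ 0ℚ ∷ p
x⊗ p = ≈-trans (0∷-⊗ one p) (∷-cong refl (⊗-identityˡ p))

scale-mono : ∀ c d k → scale c (mono d k) ≈ mono (c ℚ.* d) k
scale-mono c d zero    = ≈-refl
scale-mono c d (suc k) = ∷-cong (ℚₚ.*-zeroʳ c) (scale-mono c d k)

coeff-mono-≡ : ∀ c k → coeff (mono c k) k ≡ c
coeff-mono-≡ c zero    = refl
coeff-mono-≡ c (suc k) = coeff-mono-≡ c k

coeff-mono-≢ : ∀ c k i → i ≢ k → coeff (mono c k) i ≡ 0ℚ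
coeff-mono-≢ c zero    zero    i≢k = ⊥-elim (i≢k refl)
coeff-mono-≢ c zero    (suc i) i≢k = refl
coeff-mono-≢ c (suc k) zero    i≢k = refl
coeff-mono-≢ c (suc k) (suc i) i≢k = coeff-mono-≢ c k i (λ e → i≢k (cong suc e))

-- Degrees and reversal

-- The Cauchy product on sequences instead of lists: lengths and trailing zeros disappear, and
-- hypotheses can be stated for all pairs of indices with a given sum.
conv : (ℕ → ℚ) → (ℕ → ℚ) → ℕ → ℚ
conv f g zero    = f 0 ℚ.* g 0
conv f g (suc k) = f 0 ℚ.* g (suc k) ℚ.+ conv (f ∘ suc) g k

conv-vanish : ∀ f g k → (∀ i j → i ℕ.+ j ≡ k → f i ℚ.* g j ≡ 0ℚ) → conv f g k ≡ 0ℚ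
conv-vanish f g zero    h = h 0 0 refl
conv-vanish f g (suc k) h = cong₂ ℚ._+_ (h 0 (suc k) refl)
  (conv-vanish (f ∘ suc) g k (λ i j e → h (suc i) j (cong suc e)))

-- Serves twice: for the leading coefficient of a product, and for the m-th coefficient of F F* once
-- the support of F is known.
conv-single : ∀ f g s t → (∀ i j → i ℕ.+ j ≡ s ℕ.+ t → i ≢ s → f i ℚ.* g j ≡ 0ℚ) →
              conv f g (s ℕ.+ t) ≡ f s ℚ.* g t
conv-single f g zero    zero    h = refl
conv-single f g zero    (suc t) h = trans
  (cong (f 0 ℚ.* g (suc t) ℚ.+_) (conv-vanish (f ∘ suc) g t (λ i j e → h (suc i) j (cong suc e) (λ ()))))
  (ℚₚ.+-identityʳ _)
conv-single f g (suc s) t       h = trans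
  (cong₂ ℚ._+_ (h 0 (suc (s ℕ.+ t)) refl (λ ()))
    (conv-single (f ∘ suc) g s t (λ i j e i≢s → h (suc i) j (cong suc e) (i≢s ∘ ℕₚ.suc-injective))))
  (ℚₚ.+-identityˡ _)

coeff-⊗ : ∀ p q k → coeff (p ⊗ q) k ≡ conv (coeff p) (coeff q) k
coeff-⊗ []      q k       = sym (conv-vanish (λ _ → 0ℚ) (coeff q) k (λ i j _ → ℚₚ.*-zeroˡ (coeff q j)))
coeff-⊗ (a ∷ p) q zero    = trans (coeff-⊕ (scale a q) (0ℚ ∷ p ⊗ q) 0) (trans (ℚₚ.+-identityʳ _) (coeff-scale a q 0))
coeff-⊗ (a ∷ p) q (suc k) = trans (coeff-⊕ (scale a q) (0ℚ ∷ p ⊗ q) (suc k))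
  (cong₂ ℚ._+_ (coeff-scale a q (suc k)) (coeff-⊗ p q k))

Deg≤ : ℕ → Poly → Set
Deg≤ s p = ∀ k → s ℕ.< k → coeff p k ≡ 0ℚ

*-zeroˡ′ : ∀ {a} b → a ≡ 0ℚ → a ℚ.* b ≡ 0ℚ
*-zeroˡ′ b e = trans (cong (ℚ._* b) e) (ℚₚ.*-zeroˡ b)

*-zeroʳ′ : ∀ a {b} → b ≡ 0ℚ → a ℚ.* b ≡ 0ℚ
*-zeroʳ′ a e = trans (cong (a ℚ.*_) e) (ℚₚ.*-zeroʳ a)

deg-⊗ : ∀ {s t} p q → Deg≤ s p → Deg≤ t q → Deg≤ (s ℕ.+ t) (p ⊗ q)
deg-⊗ {s} {t} p q dp dq k s+t<k = trans (coeff-⊗ p q k) (conv-vanish (coeff p) (coeff q) k split)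
  where
  split : ∀ i j → i ℕ.+ j ≡ k → coeff p i ℚ.* coeff q j ≡ 0ℚ
  split i j e with s ℕ.<? i | t ℕ.<? j
  ... | yes s<i | _       = *-zeroˡ′ (coeff q j) (dp i s<i)
  ... | no _    | yes t<j = *-zeroʳ′ (coeff p i) (dq j t<j)
  ... | no s≮i  | no t≮j  = ⊥-elim (ℕₚ.<⇒≱ s+t<k (subst (ℕ._≤ s ℕ.+ t) e (ℕₚ.+-mono-≤ (ℕₚ.≮⇒≥ s≮i) (ℕₚ.≮⇒≥ t≮j))))

coeff-⊗-top : ∀ {s t} p q → Deg≤ s p → Deg≤ t q → coeff (p ⊗ q) (s ℕ.+ t) ≡ coeff p s ℚ.* coeff q t
coeff-⊗-top {s} {t} p q dp dq = trans (coeff-⊗ p q (s ℕ.+ t)) (conv-single (coeff p) (coeff q) s t off)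
  where
  off : ∀ i j → i ℕ.+ j ≡ s ℕ.+ t → i ≢ s → coeff p i ℚ.* coeff q j ≡ 0ℚ
  off i j e i≢s with ℕₚ.<-cmp i s
  ... | tri> _ _ s<i = *-zeroˡ′ (coeff q j) (dp i s<i)
  ... | tri≈ _ i≡s _ = ⊥-elim (i≢s i≡s)
  ... | tri< i<s _ _ = *-zeroʳ′ (coeff p i) (dq j (ℕₚ.≰⇒> λ j≤t → ℕₚ.<⇒≢ (ℕₚ.+-mono-<-≤ i<s j≤t) e))

degree : ∀ p → (p ≈ []) ⊎ ∃ λ s → (coeff p s ≢ 0ℚ) × Deg≤ s p
degree [] = inj₁ ≈-refl
degree (a ∷ p) with degree p
... | inj₂ (s , c≢0 , d) = inj₂ (suc s , c≢0 , λ { (suc k) (s≤s s<k) → d k s<k })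
... | inj₁ p≈0 with a ℚ.≟ 0ℚ
...   | yes a≡0 = inj₁ (≈-trans (∷-cong a≡0 p≈0) 0∷[])
...   | no a≢0  = inj₂ (0 , a≢0 , λ { (suc k) _ → at p≈0 k })

nonzero-product : ∀ {a b} → a ≢ 0ℚ → b ≢ 0ℚ → a ℚ.* b ≢ 0ℚ
nonzero-product {a} {b} a≢0 b≢0 ab≡0 = b≢0 (begin
  b                      ≡⟨ ℚₚ.*-identityˡ b ⟨
  1ℚ ℚ.* b               ≡⟨ cong (ℚ._* b) (ℚₚ.*-inverseˡ a) ⟨
  ℚ.1/ a ℚ.* a ℚ.* b     ≡⟨ ℚₚ.*-assoc (ℚ.1/ a) a b ⟩
  ℚ.1/ a ℚ.* (a ℚ.* b)   ≡⟨ *-zeroʳ′ (ℚ.1/ a) ab≡0 ⟩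
  0ℚ                     ∎)
  where
  open ≡.≡-Reasoning
  instance
    a-nonZero : ℚ.NonZero a
    a-nonZero = ℚ.≢-nonZero a≢0

nonconstant-degree : ∀ {p} → NonConstant p → ∃ λ s → (1 ℕ.≤ s) × (coeff p s ≢ 0ℚ) × Deg≤ s p
nonconstant-degree {p} (k , 1≤k , c≢0) with degree p
... | inj₁ p≈0 = ⊥-elim (c≢0 (at p≈0 k))
... | inj₂ (s , cs≢0 , d) = s , ℕₚ.≤-trans 1≤k (ℕₚ.≮⇒≥ λ s<k → c≢0 (d k s<k)) , cs≢0 , d

-- Leading coefficients multiply to something nonzero in positive degree. This keeps 2 and 3 nonzero
-- modulo the common divisor.
nonconstant∤constant : ∀ {u} q {c} → NonConstant u → c ≢ 0ℚ → ¬ (u ⊗ q ≈ c ∷ [])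
nonconstant∤constant {u} q {c} nc c≢0 e with nonconstant-degree {u} nc | degree q
... | s , 1≤s , us≢0 , du | inj₁ q≈0 = c≢0 (sym (at (≈-trans (≈-sym (≈-trans (⊗-congʳ u q≈0) (⊗-zeroʳ u))) e) 0))
... | suc s , 1≤s , us≢0 , du | inj₂ (t , qt≢0 , dq) =
  nonzero-product us≢0 qt≢0 (trans (sym (coeff-⊗-top u q du dq)) (at e (suc s ℕ.+ t)))

-- rev t p is x^t p(1/x), truncated to the coefficients of p of index at most t.
rev : ℕ → Poly → Poly
rev t       []      = []
rev zero    (a ∷ p) = a ∷ []
rev (suc t) (a ∷ p) = mono a (suc t) ⊕ rev t p

deg-rev : ∀ t p → Deg≤ t (rev t p)
deg-rev t       []      k       t<k = refl
deg-rev zero    (a ∷ p) (suc k) t<k = refl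
deg-rev (suc t) (a ∷ p) k       t<k = trans (coeff-⊕ (mono a (suc t)) (rev t p) k)
  (cong₂ ℚ._+_ (coeff-mono-≢ a (suc t) k (ℕₚ.>⇒≢ t<k)) (deg-rev t p k (ℕₚ.<-trans (ℕₚ.n<1+n t) t<k)))

coeff-rev : ∀ t p i j → i ℕ.+ j ≡ t → coeff (rev t p) i ≡ coeff p j
coeff-rev t       []      i       j       e = refl
coeff-rev zero    (a ∷ p) zero    zero    e = refl
coeff-rev (suc t) (a ∷ p) i       zero    e with trans (sym (ℕₚ.+-identityʳ i)) e
... | refl = trans (coeff-⊕ (mono a (suc t)) (rev t p) (suc t))
  (trans (cong₂ ℚ._+_ (coeff-mono-≡ a (suc t)) (deg-rev t p (suc t) (ℕₚ.n<1+n t))) (ℚₚ.+-identityʳ a))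
coeff-rev (suc t) (a ∷ p) i       (suc j) e = trans (coeff-⊕ (mono a (suc t)) (rev t p) i)
  (trans (cong₂ ℚ._+_ (coeff-mono-≢ a (suc t) i i≢) (coeff-rev t p i j i+j≡t)) (ℚₚ.+-identityˡ _))
  where
  i+j≡t : i ℕ.+ j ≡ t
  i+j≡t = ℕₚ.suc-injective (trans (sym (ℕₚ.+-suc i j)) e)
  i≢ : i ≢ suc t
  i≢ refl = ℕₚ.<⇒≱ (ℕₚ.n<1+n t) (subst (suc t ℕ.≤_) i+j≡t (ℕₚ.m≤m+n (suc t) j))

-- The algebraic rules for `rev` are obtained from this characterisation by coefficients, which
-- bypasses the recursion that defines `rev`.
rev-unique : ∀ t p q → Deg≤ t q → (∀ i j → i ℕ.+ j ≡ t → coeff q i ≡ coeff p j) → q ≈ rev t p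
rev-unique t p q d h = mk go
  where
  go : q ≈ₚ rev t p
  go i with i ℕ.≤? t
  ... | yes i≤t = trans (h i (t ℕ.∸ i) (ℕₚ.m+[n∸m]≡n i≤t)) (sym (coeff-rev t p i (t ℕ.∸ i) (ℕₚ.m+[n∸m]≡n i≤t)))
  ... | no i≰t  = trans (d i (ℕₚ.≰⇒> i≰t)) (sym (deg-rev t p i (ℕₚ.≰⇒> i≰t)))

rev-cong : ∀ t {p q} → p ≈ q → rev t p ≈ rev t q
rev-cong t {p} {q} e = rev-unique t q (rev t p) (deg-rev t p) (λ i j i+j≡t → trans (coeff-rev t p i j i+j≡t) (at e j))

rev-⊕ : ∀ t p q → rev t (p ⊕ q) ≈ rev t p ⊕ rev t q
rev-⊕ t p q = ≈-sym (rev-unique t (p ⊕ q) (rev t p ⊕ rev t q)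
  (λ k t<k → trans (coeff-⊕ (rev t p) (rev t q) k) (cong₂ ℚ._+_ (deg-rev t p k t<k) (deg-rev t q k t<k)))
  (λ i j e → trans (coeff-⊕ (rev t p) (rev t q) i)
    (trans (cong₂ ℚ._+_ (coeff-rev t p i j e) (coeff-rev t q i j e)) (sym (coeff-⊕ p q j)))))

rev-scale : ∀ t c p → rev t (scale c p) ≈ scale c (rev t p)
rev-scale t c p = ≈-sym (rev-unique t (scale c p) (scale c (rev t p))
  (λ k t<k → trans (coeff-scale c (rev t p) k) (*-zeroʳ′ c (deg-rev t p k t<k)))
  (λ i j e → trans (coeff-scale c (rev t p) i) (trans (cong (c ℚ.*_) (coeff-rev t p i j e)) (sym (coeff-scale c p j)))))

rev-suc : ∀ t p → Deg≤ t p → rev (suc t) p ≈ 0ℚ ∷ rev t p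
rev-suc t p d = ≈-sym (rev-unique (suc t) p (0ℚ ∷ rev t p)
  (λ { (suc k) (s≤s t<k) → deg-rev t p k t<k })
  (λ { zero .(suc t) refl → sym (d (suc t) (ℕₚ.n<1+n t))
     ; (suc i) j e → coeff-rev t p i j (ℕₚ.suc-injective e) }))

-- x^(s+t) p(1/x) = x^s · x^t p(1/x): a degree bound with slack `s` costs a factor x^s. The scalar
-- `a` is the constant coefficient of the left factor in `rev-⊗`, which reversal sends to
-- `mono a s`.
rev-shift : ∀ s t a p → Deg≤ t p → scale a (rev (s ℕ.+ t) p) ≈ mono a s ⊗ rev t p
rev-shift zero    t a p d = ≈-sym (≈-trans (⊕-cong ≈-refl 0∷[]) (⊕-identityʳ _))
rev-shift (suc s) t a p d = begin
  scale a (rev (suc (s ℕ.+ t)) p)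
    ≈⟨ scale-cong refl (rev-suc (s ℕ.+ t) p (λ k l → d k (ℕₚ.≤-<-trans (ℕₚ.m≤n+m t s) l))) ⟩
  a ℚ.* 0ℚ ∷ scale a (rev (s ℕ.+ t) p)    ≈⟨ ∷-cong (ℚₚ.*-zeroʳ a) (rev-shift s t a p d) ⟩
  0ℚ ∷ mono a s ⊗ rev t p                 ≈⟨ 0∷-⊗ (mono a s) (rev t p) ⟨
  mono a (suc s) ⊗ rev t p                ∎
  where open PolyReasoning

mono-zero : ∀ k → mono 0ℚ k ≈ []
mono-zero zero    = 0∷[]
mono-zero (suc k) = ≈-trans (∷-cong refl (mono-zero k)) 0∷[]

rev-⊗ : ∀ s t p q → Deg≤ s p → Deg≤ t q → rev (s ℕ.+ t) (p ⊗ q) ≈ rev s p ⊗ rev t q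
rev-⊗ s       t []      q dp dq = ≈-refl
rev-⊗ zero    t (a ∷ p) q dp dq = begin
  rev t (scale a q ⊕ (0ℚ ∷ p ⊗ q))
    ≈⟨ rev-cong t (⊕-cong (≈-refl {scale a q}) (≈-trans (∷-cong refl (⊗-cong p≈0 (≈-refl {q}))) 0∷[])) ⟩
  rev t (scale a q ⊕ [])             ≈⟨ rev-cong t (⊕-identityʳ (scale a q)) ⟩
  rev t (scale a q)                  ≈⟨ rev-scale t a q ⟩
  scale a (rev t q)                  ≈⟨ rev-shift 0 t a q dq ⟩
  (a ∷ []) ⊗ rev t q                 ∎
  where
  open PolyReasoning
  -- Degree at most 0 still allows a tail of zeros in the list.
  p≈0 : p ≈ []
  p≈0 = mk λ k → dp (suc k) (s≤s z≤n)
rev-⊗ (suc s) t (a ∷ p) q dp dq = begin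
  rev (suc (s ℕ.+ t)) (scale a q ⊕ (0ℚ ∷ p ⊗ q))
    ≈⟨ rev-⊕ (suc (s ℕ.+ t)) (scale a q) (0ℚ ∷ p ⊗ q) ⟩
  rev (suc (s ℕ.+ t)) (scale a q) ⊕ (mono 0ℚ (suc (s ℕ.+ t)) ⊕ rev (s ℕ.+ t) (p ⊗ q))
    ≈⟨ ⊕-cong (≈-trans (rev-scale (suc (s ℕ.+ t)) a q) (rev-shift (suc s) t a q dq))
              (⊕-cong (mono-zero (suc (s ℕ.+ t))) (rev-⊗ s t p q (λ k l → dp (suc k) (s≤s l)) dq)) ⟩
  mono a (suc s) ⊗ rev t q ⊕ rev s p ⊗ rev t q
    ≈⟨ ⊗-distribʳ (rev t q) (mono a (suc s)) (rev s p) ⟨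
  (mono a (suc s) ⊕ rev s p) ⊗ rev t q ∎
  where open PolyReasoning

rev-rev : ∀ t p → Deg≤ t p → rev t (rev t p) ≈ p
rev-rev t p d = ≈-sym (rev-unique t (rev t p) p d (λ i j e → sym (coeff-rev t p j i (trans (ℕₚ.+-comm j i) e))))

-- Gauss's lemma

-- Opaque, so that unification does not unfold the gcd normalisation in _/_.
opaque
  ι : ℤ → ℚ
  ι z = z ℚ./ 1

  ι-injective : ∀ {a b} → ι a ≡ ι b → a ≡ b
  ι-injective {a} {b} e with ℚₚ./-injective-≃ (mkℚᵘ a 0) (mkℚᵘ b 0) e
  ... | *≡* eq = trans (sym (ℤₚ.*-identityʳ a)) (trans eq (ℤₚ.*-identityʳ b))

  ι-+ : ∀ a b → ι (a ℤ.+ b) ≡ ι a ℚ.+ ι b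
  ι-+ a b = ℚₚ.toℚᵘ-injective (begin
    ℚ.toℚᵘ (ι (a ℤ.+ b))                    ≈⟨ ℚₚ.toℚᵘ-fromℚᵘ (mkℚᵘ (a ℤ.+ b) 0) ⟩
    mkℚᵘ (a ℤ.+ b) 0
      ≡⟨ cong₂ (λ u v → mkℚᵘ (u ℤ.+ v) 0) (ℤₚ.*-identityʳ a) (ℤₚ.*-identityʳ b) ⟨
    mkℚᵘ a 0 ℚᵘ.+ mkℚᵘ b 0
      ≈⟨ ℚᵘₚ.+-cong (ℚₚ.toℚᵘ-fromℚᵘ (mkℚᵘ a 0)) (ℚₚ.toℚᵘ-fromℚᵘ (mkℚᵘ b 0)) ⟨
    ℚ.toℚᵘ (ι a) ℚᵘ.+ ℚ.toℚᵘ (ι b)          ≈⟨ ℚₚ.toℚᵘ-homo-+ (ι a) (ι b) ⟨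
    ℚ.toℚᵘ (ι a ℚ.+ ι b)                    ∎)
    where open ℚᵘₚ.≃-Reasoning

  ι-* : ∀ a b → ι (a ℤ.* b) ≡ ι a ℚ.* ι b
  ι-* a b = ℚₚ.toℚᵘ-injective (begin
    ℚ.toℚᵘ (ι (a ℤ.* b))                    ≈⟨ ℚₚ.toℚᵘ-fromℚᵘ (mkℚᵘ (a ℤ.* b) 0) ⟩
    mkℚᵘ a 0 ℚᵘ.* mkℚᵘ b 0
      ≈⟨ ℚᵘₚ.*-cong (ℚₚ.toℚᵘ-fromℚᵘ (mkℚᵘ a 0)) (ℚₚ.toℚᵘ-fromℚᵘ (mkℚᵘ b 0)) ⟨
    ℚ.toℚᵘ (ι a) ℚᵘ.* ℚ.toℚᵘ (ι b)          ≈⟨ ℚₚ.toℚᵘ-homo-* (ι a) (ι b) ⟨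
    ℚ.toℚᵘ (ι a ℚ.* ι b)                    ∎)
    where open ℚᵘₚ.≃-Reasoning

  ι-0 : ι +0 ≡ 0ℚ
  ι-0 = refl

  ι-1 : ι (+ 1) ≡ 1ℚ
  ι-1 = refl

  ι-[-1] : ι -[1+ 0 ] ≡ ℚ.- 1ℚ
  ι-[-1] = refl

  ι-3 : ι (+ 3) ≡ 1ℚ ℚ.+ 1ℚ ℚ.+ 1ℚ
  ι-3 = refl

  clear-denominator : ∀ q → ∃ λ z → ι (+ ℚ.↧ₙ q) ℚ.* q ≡ ι z
  clear-denominator q@(mkℚ z d _) = z , ℚₚ.toℚᵘ-injective (begin
    ℚ.toℚᵘ (ι (+ suc d) ℚ.* q)                ≈⟨ ℚₚ.toℚᵘ-homo-* (ι (+ suc d)) q ⟩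
    ℚ.toℚᵘ (ι (+ suc d)) ℚᵘ.* mkℚᵘ z d        ≈⟨ ℚᵘₚ.*-cong (ℚₚ.toℚᵘ-fromℚᵘ (mkℚᵘ (+ suc d) 0)) ℚᵘₚ.≃-refl ⟩
    mkℚᵘ (+ suc d) 0 ℚᵘ.* mkℚᵘ z d
      ≈⟨ *≡* (trans (ℤₚ.*-identityʳ (+ suc d ℤ.* z)) (trans (ℤₚ.*-comm (+ suc d) z) (cong (λ k → z ℤ.* + suc k) (sym (ℕₚ.+-identityʳ d))))) ⟩
    mkℚᵘ z 0                                  ≈⟨ ℚₚ.toℚᵘ-fromℚᵘ (mkℚᵘ z 0) ⟨
    ℚ.toℚᵘ (ι z)                              ∎)
    where open ℚᵘₚ.≃-Reasoning

ι-neg : ∀ a → ι (ℤ.- a) ≡ ℚ.- ι a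
ι-neg a = ℚ-Props.+-cancelʳ (ι a) _ _ (trans (sym (ι-+ (ℤ.- a) a))
  (trans (cong ι (ℤₚ.+-inverseˡ a)) (trans ι-0 (sym (ℚₚ.+-inverseˡ (ι a))))))

ι≢0 : ∀ {n} → n ≢ 0 → ι (+ n) ≢ 0ℚ
ι≢0 n≢0 e = n≢0 (ℤₚ.+-injective (ι-injective (trans e (sym ι-0))))

Integral : ℚ → Set
Integral q = ∃ λ z → q ≡ ι z

integral-+ : ∀ {a b} → Integral a → Integral b → Integral (a ℚ.+ b)
integral-+ (z , e) (w , f) = z ℤ.+ w , trans (cong₂ ℚ._+_ e f) (sym (ι-+ z w))

integral-* : ∀ {a b} → Integral a → Integral b → Integral (a ℚ.* b)
integral-* (z , e) (w , f) = z ℤ.* w , trans (cong₂ ℚ._*_ e f) (sym (ι-* z w))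

integral-neg : ∀ {a} → Integral a → Integral (ℚ.- a)
integral-neg (z , e) = ℤ.- z , trans (cong (ℚ.-_) e) (sym (ι-neg z))

-- Divisibility in ℤ, phrased inside ℚ as `Integral` is, so that ℤ[x] is a predicate on `Poly` and
-- needs no polynomials of its own.
Multiple : ℕ → ℚ → Set
Multiple c q = ∃ λ r → Integral r × (q ≡ ι (+ c) ℚ.* r)

module _ (c : ℕ) where
  multiple-0 : Multiple c 0ℚ
  multiple-0 = 0ℚ , (+0 , sym ι-0) , sym (ℚₚ.*-zeroʳ (ι (+ c)))

  multiple-+ : ∀ {a b} → Multiple c a → Multiple c b → Multiple c (a ℚ.+ b)
  multiple-+ (r , ir , e) (s , is , f) = r ℚ.+ s , integral-+ ir is ,
    trans (cong₂ ℚ._+_ e f) (sym (ℚₚ.*-distribˡ-+ (ι (+ c)) r s))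

  multiple-neg : ∀ {a} → Multiple c a → Multiple c (ℚ.- a)
  multiple-neg (r , ir , e) = ℚ.- r , integral-neg ir , trans (cong (ℚ.-_) e) (ℚₚ.neg-distribʳ-* (ι (+ c)) r)

  multiple-*ˡ : ∀ {a b} → Multiple c a → Integral b → Multiple c (a ℚ.* b)
  multiple-*ˡ {b = b} (r , ir , e) ib = r ℚ.* b , integral-* ir ib , trans (cong (ℚ._* b) e) (ℚₚ.*-assoc (ι (+ c)) r b)

  multiple-cancel : ∀ {a b} → Multiple c a → Multiple c (a ℚ.+ b) → Multiple c b
  multiple-cancel {a} {b} ma mab = subst (Multiple c) eq (multiple-+ (multiple-neg ma) mab)
    where
    eq : ℚ.- a ℚ.+ (a ℚ.+ b) ≡ b
    eq = trans (sym (ℚₚ.+-assoc (ℚ.- a) a b)) (trans (cong (ℚ._+ b) (ℚₚ.+-inverseˡ a)) (ℚₚ.+-identityˡ b))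

  ∣⇒multiple : ∀ z → c ∣ ℤ.∣ z ∣ → Multiple c (ι z)
  ∣⇒multiple z d with ℤ-Signed.∣ᵤ⇒∣ {+ c} {z} d
  ... | ℤ-Signed.divides q e = ι q , (q , refl) , trans (cong ι (trans e (ℤₚ.*-comm q (+ c)))) (ι-* (+ c) q)

  multiple⇒∣ : ∀ z → Multiple c (ι z) → c ∣ ℤ.∣ z ∣
  multiple⇒∣ z (r , (w , refl) , e) = ℤ-Signed.∣⇒∣ᵤ {+ c} {z}
    (ℤ-Signed.divides w (trans (ι-injective (trans e (sym (ι-* (+ c) w)))) (ℤₚ.*-comm (+ c) w)))

  multiple? : ∀ {q} → Integral q → Dec (Multiple c q)
  multiple? (z , refl) with c ∣? ℤ.∣ z ∣
  ... | yes d = yes (∣⇒multiple z d)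
  ... | no ¬d = no (¬d ∘ multiple⇒∣ z)

multiple-prime : ∀ {p a b} → Prime p → Integral a → Integral b → Multiple p (a ℚ.* b) → Multiple p a ⊎ Multiple p b
multiple-prime {p} pr (z , refl) (w , refl) m
  with euclidsLemma ℤ.∣ z ∣ ℤ.∣ w ∣ pr (subst (p ∣_) (ℤₚ.abs-* z w)
         (multiple⇒∣ p (z ℤ.* w) (subst (Multiple p) (sym (ι-* z w)) m)))
... | inj₁ d = inj₁ (∣⇒multiple p z d)
... | inj₂ d = inj₂ (∣⇒multiple p w d)

Coeffs : (ℚ → Set) → Poly → Set
Coeffs P p = ∀ k → P (coeff p k)

module _ {p : ℕ} (pr : Prime p) where
  -- The constant coefficient of the product is a b, so `p` divides b. Subtracting b times the left
  -- factor leaves x times the product with the tail of the right factor, and the argument repeats.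
  gauss-∷ : ∀ a g h → ¬ Multiple p a → Coeffs Integral (a ∷ g) → Coeffs Integral h →
            Coeffs (Multiple p) ((a ∷ g) ⊗ h) → Coeffs (Multiple p) h
  gauss-∷ a g []      ¬ma ig ih m k = multiple-0 p
  gauss-∷ a g (b ∷ h) ¬ma ig ih m = λ { zero → mb ; (suc k) → gauss-∷ a g h ¬ma ig (ih ∘ suc) m′ k }
    where
    mb : Multiple p b
    mb with multiple-prime pr (ig 0) (ih 0) (subst (Multiple p) (ℚₚ.+-identityʳ (a ℚ.* b)) (m 0))
    ... | inj₁ ma = ⊥-elim (¬ma ma)
    ... | inj₂ mb = mb
    m′ : Coeffs (Multiple p) ((a ∷ g) ⊗ h)
    m′ k = multiple-cancel p (multiple-*ˡ p mb (ig (suc k))) (subst (Multiple p)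
      (trans (at (⊗-∷ (a ∷ g) b h) (suc k)) (trans (coeff-⊕ (scale b (a ∷ g)) (0ℚ ∷ (a ∷ g) ⊗ h) (suc k))
        (cong (ℚ._+ coeff ((a ∷ g) ⊗ h) k) (coeff-scale b (a ∷ g) (suc k))))) (m (suc k)))

  -- Low coefficients of `g` divisible by `p` are stripped off, their contribution to the product
  -- being divisible too. At the first coefficient that is not divisible, `gauss-∷` takes over; if
  -- there is none, `p` divides all of `g`.
  gauss : ∀ g h → Coeffs Integral g → Coeffs Integral h → Coeffs (Multiple p) (g ⊗ h) →
          Coeffs (Multiple p) g ⊎ Coeffs (Multiple p) h
  gauss []      h ig ih m = inj₁ (λ _ → multiple-0 p)
  gauss (a ∷ g) h ig ih m = split (multiple? p (ig 0))
    where
    m′ : Multiple p a → Coeffs (Multiple p) (g ⊗ h)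
    m′ ma k = multiple-cancel p (multiple-*ˡ p ma (ih (suc k)))
      (subst (Multiple p) (trans (coeff-⊕ (scale a h) (0ℚ ∷ g ⊗ h) (suc k))
        (cong (ℚ._+ coeff (g ⊗ h) k) (coeff-scale a h (suc k)))) (m (suc k)))

    prepend : Multiple p a → Coeffs (Multiple p) g → Coeffs (Multiple p) (a ∷ g)
    prepend ma mg zero    = ma
    prepend ma mg (suc k) = mg k

    split : Dec (Multiple p a) → Coeffs (Multiple p) (a ∷ g) ⊎ Coeffs (Multiple p) h
    split (no ¬ma) = inj₂ (gauss-∷ a g h ¬ma ig ih m)
    split (yes ma) = Sum.map₁ (prepend ma) (gauss g h (ig ∘ suc) ih (m′ ma))

scale-nonconstant : ∀ c p → c ≢ 0ℚ → NonConstant p → NonConstant (scale c p)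
scale-nonconstant c p c≢0 (k , 1≤k , pk≢0) = k , 1≤k , λ e → nonzero-product c≢0 pk≢0 (trans (sym (coeff-scale c p k)) e)

inverse : ∀ {c} → c ≢ 0ℚ → ∃ λ r → (r ≢ 0ℚ) × (r ℚ.* c ≡ 1ℚ)
inverse {c} c≢0 = ℚ.1/ c , (λ e → ℚ1≢0 (trans (sym (ℚₚ.*-inverseˡ c)) (*-zeroˡ′ c e))) , ℚₚ.*-inverseˡ c
  where
  instance
    c-nonZero : ℚ.NonZero c
    c-nonZero = ℚ.≢-nonZero c≢0
  ℚ1≢0 : 1ℚ ≢ 0ℚ
  ℚ1≢0 ()

divide-integral : ∀ c {r} p → r ℚ.* ι (+ c) ≡ 1ℚ → Coeffs (Multiple c) p → Coeffs Integral (scale r p)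
divide-integral c {r} p rc≡1 m k with m k
... | s , is , e = subst Integral (sym (begin
  coeff (scale r p) k          ≡⟨ coeff-scale r p k ⟩
  r ℚ.* coeff p k              ≡⟨ cong (r ℚ.*_) e ⟩
  r ℚ.* (ι (+ c) ℚ.* s)        ≡⟨ ℚₚ.*-assoc r (ι (+ c)) s ⟨
  r ℚ.* ι (+ c) ℚ.* s          ≡⟨ cong (ℚ._* s) rc≡1 ⟩
  1ℚ ℚ.* s                     ≡⟨ ℚₚ.*-identityˡ s ⟩
  s                            ∎)) is
  where open ≡.≡-Reasoning

record IntegralFactors (f : Poly) : Set where
  constructor factors
  field
    g h           : Poly
    g-integral    : Coeffs Integral g
    h-integral    : Coeffs Integral h
    g-nonconstant : NonConstant g
    h-nonconstant : NonConstant h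
    product≈      : g ⊗ h ≈ f

⊗-scale : ∀ c p q → p ⊗ scale c q ≈ scale c (p ⊗ q)
⊗-scale c p q = ≈-trans (⊗-comm p (scale c q)) (≈-trans (scale-⊗ c q p) (scale-cong refl (⊗-comm q p)))

ι-*ℕ : ∀ a b → ι (+ (a ℕ.* b)) ≡ ι (+ a) ℚ.* ι (+ b)
ι-*ℕ a b = trans (cong ι (ℤₚ.pos-* a b)) (ι-* (+ a) (+ b))

-- The primes of the cleared denominator are removed one at a time: each divides every coefficient
-- of g h, hence by `gauss` every coefficient of one factor, and that factor is divided by it.
descend : ∀ {f} → Coeffs Integral f → ∀ {ps} → All Prime ps →
          IntegralFactors (scale (ι (+ product ps)) f) → IntegralFactors f
descend {f} if [] (factors g h ig ih ng nh e) =
  factors g h ig ih ng nh (≈-trans e (≈-trans (scale-cong ι-1 (≈-refl {f})) (scale-one f)))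
descend {f} if {p ∷ ps} (pr ∷ prs) (factors g h ig ih ng nh e) = descend if prs (reduce (gauss pr g h ig ih m))
  where
  P = product ps

  p≢0 : ι (+ p) ≢ 0ℚ
  p≢0 = ι≢0 (ℕ.≢-nonZero⁻¹ p {{prime⇒nonZero pr}})

  m : Coeffs (Multiple p) (g ⊗ h)
  m k = ι (+ P) ℚ.* coeff f k , integral-* (+ P , refl) (if k) , (begin
    coeff (g ⊗ h) k                              ≡⟨ at e k ⟩
    coeff (scale (ι (+ (p ℕ.* P))) f) k          ≡⟨ coeff-scale (ι (+ (p ℕ.* P))) f k ⟩
    ι (+ (p ℕ.* P)) ℚ.* coeff f k                ≡⟨ cong (ℚ._* coeff f k) (ι-*ℕ p P) ⟩
    ι (+ p) ℚ.* ι (+ P) ℚ.* coeff f k            ≡⟨ ℚₚ.*-assoc (ι (+ p)) (ι (+ P)) (coeff f k) ⟩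
    ι (+ p) ℚ.* (ι (+ P) ℚ.* coeff f k)          ∎)
    where open ≡.≡-Reasoning

  r = proj₁ (inverse p≢0)

  r≢0 : r ≢ 0ℚ
  r≢0 = proj₁ (proj₂ (inverse p≢0))

  rp≡1 : r ℚ.* ι (+ p) ≡ 1ℚ
  rp≡1 = proj₂ (proj₂ (inverse p≢0))

  divided : scale r (g ⊗ h) ≈ scale (ι (+ P)) f
  divided = begin
    scale r (g ⊗ h)                        ≈⟨ scale-cong refl e ⟩
    scale r (scale (ι (+ (p ℕ.* P))) f)    ≈⟨ scale-* r (ι (+ (p ℕ.* P))) f ⟩
    scale (r ℚ.* ι (+ (p ℕ.* P))) f        ≈⟨ scale-cong rpP≡P (≈-refl {f}) ⟩
    scale (ι (+ P)) f                      ∎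
    where
    open PolyReasoning
    rpP≡P : r ℚ.* ι (+ (p ℕ.* P)) ≡ ι (+ P)
    rpP≡P = trans (cong (r ℚ.*_) (ι-*ℕ p P)) (trans (sym (ℚₚ.*-assoc r (ι (+ p)) (ι (+ P))))
              (trans (cong (ℚ._* ι (+ P)) rp≡1) (ℚₚ.*-identityˡ (ι (+ P)))))

  reduce : Coeffs (Multiple p) g ⊎ Coeffs (Multiple p) h → IntegralFactors (scale (ι (+ P)) f)
  reduce (inj₁ mg) = factors (scale r g) h (divide-integral p g rp≡1 mg) ih (scale-nonconstant r g r≢0 ng) nh
                       (≈-trans (scale-⊗ r g h) divided)
  reduce (inj₂ mh) = factors g (scale r h) ig (divide-integral p h rp≡1 mh) ng (scale-nonconstant r h r≢0 nh)
                       (≈-trans (⊗-scale r g h) divided)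

clear-denominators : ∀ p → ∃ λ c → (c ≢ 0) × Coeffs Integral (scale (ι (+ c)) p)
clear-denominators []      = 1 , (λ ()) , λ _ → +0 , sym ι-0
clear-denominators (q ∷ p) with clear-denominators p
... | c , c≢0 , ip = ℚ.↧ₙ q ℕ.* c , (λ e → c≢0 (ℕₚ.m*n≡0⇒m≡0 c (ℚ.↧ₙ q) (trans (ℕₚ.*-comm c (ℚ.↧ₙ q)) e))) ,
  λ { zero → subst Integral (begin
        ι (+ c) ℚ.* (ι (+ d) ℚ.* q)
          ≡⟨ solve 3 (λ c d q → c :* (d :* q) := d :* c :* q) refl (ι (+ c)) (ι (+ d)) q ⟩
        ι (+ d) ℚ.* ι (+ c) ℚ.* q        ≡⟨ cong (ℚ._* q) (ι-*ℕ d c) ⟨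
        ι (+ (d ℕ.* c)) ℚ.* q            ∎) (integral-* (+ c , refl) (clear-denominator q))
    ; (suc k) → subst Integral (begin
        ι (+ d) ℚ.* coeff (scale (ι (+ c)) p) k   ≡⟨ cong (ι (+ d) ℚ.*_) (coeff-scale (ι (+ c)) p k) ⟩
        ι (+ d) ℚ.* (ι (+ c) ℚ.* coeff p k)       ≡⟨ ℚₚ.*-assoc (ι (+ d)) (ι (+ c)) (coeff p k) ⟨
        ι (+ d) ℚ.* ι (+ c) ℚ.* coeff p k         ≡⟨ cong (ℚ._* coeff p k) (ι-*ℕ d c) ⟨
        ι (+ (d ℕ.* c)) ℚ.* coeff p k             ≡⟨ coeff-scale (ι (+ (d ℕ.* c))) p k ⟨
        coeff (scale (ι (+ (d ℕ.* c))) p) k       ∎) (integral-* (+ d , refl) (ip k)) }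
  where
  d = ℚ.↧ₙ q
  open ≡.≡-Reasoning
  open ℚ-Solver

integral-factors : ∀ {f} → Coeffs Integral f → Reducible f → IntegralFactors f
integral-factors {f} if (g , h , ng , nh , e) with clear-denominators g | clear-denominators h
... | c , c≢0 , ig | d , d≢0 , ih = descend if (PrimeFactorisation.factorsPrime pf) (factors
    (scale (ι (+ c)) g) (scale (ι (+ d)) h) ig ih
    (scale-nonconstant (ι (+ c)) g (ι≢0 c≢0) ng) (scale-nonconstant (ι (+ d)) h (ι≢0 d≢0) nh) (begin
      scale (ι (+ c)) g ⊗ scale (ι (+ d)) h     ≈⟨ scale-⊗ (ι (+ c)) g (scale (ι (+ d)) h) ⟩
      scale (ι (+ c)) (g ⊗ scale (ι (+ d)) h)   ≈⟨ scale-cong refl (⊗-scale (ι (+ d)) g h) ⟩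
      scale (ι (+ c)) (scale (ι (+ d)) (g ⊗ h)) ≈⟨ scale-* (ι (+ c)) (ι (+ d)) (g ⊗ h) ⟩
      scale (ι (+ c) ℚ.* ι (+ d)) (g ⊗ h)
        ≈⟨ scale-cong (trans (sym (ι-*ℕ c d)) (cong (λ n → ι (+ n)) (PrimeFactorisation.isFactorisation pf))) (mk e) ⟩
      scale (ι (+ product (PrimeFactorisation.factors pf))) f  ∎))
  where
  open PolyReasoning
  instance
    c-nonZero : ℕ.NonZero c
    c-nonZero = ℕ.≢-nonZero c≢0
    d-nonZero : ℕ.NonZero d
    d-nonZero = ℕ.≢-nonZero d≢0
  pf : PrimeFactorisation (c ℕ.* d)
  pf = factorise (c ℕ.* d) {{ℕₚ.m*n≢0 c d}}

-- Polynomials with the norm of a trinomial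

-- Both ends 0 and n are included. The recursion shifts the sequence just as `conv` does, so the two
-- can be compared by a plain induction.
sumSq : (ℕ → ℕ) → ℕ → ℕ
sumSq N zero    = N 0 ℕ.* N 0
sumSq N (suc n) = N 0 ℕ.* N 0 ℕ.+ sumSq (N ∘ suc) n

-- Overwriting an entry by 0 takes its square out of the sum without renumbering the others.
erase : ℕ → (ℕ → ℕ) → ℕ → ℕ
erase zero    N zero    = 0
erase zero    N (suc i) = N (suc i)
erase (suc k) N zero    = N 0
erase (suc k) N (suc i) = erase k (N ∘ suc) i

erase-≢ : ∀ k N {i} → i ≢ k → erase k N i ≡ N i
erase-≢ zero    N {zero}  i≢k = ⊥-elim (i≢k refl)
erase-≢ zero    N {suc i} i≢k = refl
erase-≢ (suc k) N {zero}  i≢k = refl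
erase-≢ (suc k) N {suc i} i≢k = erase-≢ k (N ∘ suc) (i≢k ∘ cong suc)

sumSq-erase : ∀ N {k n} → k ℕ.≤ n → sumSq N n ≡ N k ℕ.* N k ℕ.+ sumSq (erase k N) n
sumSq-erase N {zero}  {zero}  z≤n = sym (ℕₚ.+-identityʳ _)
sumSq-erase N {zero}  {suc n} z≤n = refl
sumSq-erase N {suc k} {suc n} (s≤s k≤n) = begin
  a ℕ.+ sumSq (N ∘ suc) n                      ≡⟨ cong (a ℕ.+_) (sumSq-erase (N ∘ suc) k≤n) ⟩
  a ℕ.+ (b ℕ.+ c)                              ≡⟨ ℕₚ.+-assoc a b c ⟨
  a ℕ.+ b ℕ.+ c                                ≡⟨ cong (ℕ._+ c) (ℕₚ.+-comm a b) ⟩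
  b ℕ.+ a ℕ.+ c                                ≡⟨ ℕₚ.+-assoc b a c ⟩
  b ℕ.+ (a ℕ.+ c)                              ∎
  where
  open ≡.≡-Reasoning
  a = N 0 ℕ.* N 0
  b = N (suc k) ℕ.* N (suc k)
  c = sumSq (erase k (N ∘ suc)) n

square-positive : ∀ a → a ≢ 0 → 1 ℕ.≤ a ℕ.* a
square-positive zero    a≢0 = ⊥-elim (a≢0 refl)
square-positive (suc a) _   = s≤s z≤n

sumSq-< : ∀ N {k n s} → k ℕ.≤ n → N k ≢ 0 → sumSq N n ℕ.≤ suc s → sumSq (erase k N) n ℕ.≤ s
sumSq-< N {k} k≤n Nk≢0 le = ℕₚ.≤-pred (ℕₚ.≤-trans (ℕₚ.+-monoˡ-≤ _ (square-positive (N k) Nk≢0))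
  (subst (ℕ._≤ _) (sumSq-erase N k≤n) le))

-- A nonzero natural number has square at least 1, so three nonzero entries exhaust the sum.
three-in-support : ∀ N {n a b c} → sumSq N n ≡ 3 → a ℕ.≤ n → b ℕ.≤ n → c ℕ.≤ n →
  a ≢ b → a ≢ c → b ≢ c → N a ≢ 0 → N b ≢ 0 → N c ≢ 0 →
  ∀ {i} → i ℕ.≤ n → i ≢ a → i ≢ b → i ≢ c → N i ≡ 0
three-in-support N {n} {a} {b} {c} e a≤n b≤n c≤n a≢b a≢c b≢c Na Nb Nc {i} i≤n i≢a i≢b i≢c with N i ℕ.≟ 0
... | yes z = z
... | no nz = ⊥-elim (ℕₚ.n≮0 (begin
  1                                              ≤⟨ square-positive (N₃ i) N₃i≢0 ⟩
  N₃ i ℕ.* N₃ i                                  ≤⟨ ℕₚ.m≤m+n _ _ ⟩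
  N₃ i ℕ.* N₃ i ℕ.+ sumSq (erase i N₃) n         ≡⟨ sumSq-erase N₃ i≤n ⟨
  sumSq N₃ n                                     ≤⟨ le₃ ⟩
  0                                              ∎))
  where
  open ℕₚ.≤-Reasoning
  N₁ = erase a N
  N₂ = erase b N₁
  N₃ = erase c N₂
  le₃ : sumSq N₃ n ℕ.≤ 0
  le₃ = sumSq-< N₂ c≤n (λ z → Nc (trans (sym (trans (erase-≢ b N₁ (b≢c ∘ sym)) (erase-≢ a N (a≢c ∘ sym)))) z))
          (sumSq-< N₁ b≤n (λ z → Nb (trans (sym (erase-≢ a N (a≢b ∘ sym))) z))
            (sumSq-< N a≤n Na (ℕₚ.≤-reflexive e)))
  N₃i≢0 : N₃ i ≢ 0
  N₃i≢0 z = nz (trans (sym (trans (erase-≢ c N₂ i≢c) (trans (erase-≢ b N₁ i≢b) (erase-≢ a N i≢a)))) z)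

conv-nonzero : ∀ f g k → conv f g k ≢ 0ℚ → ∃ λ i → ∃ λ j → (i ℕ.+ j ≡ k) × (f i ≢ 0ℚ) × (g j ≢ 0ℚ)
conv-nonzero f g zero    h = 0 , 0 , refl , (λ z → h (*-zeroˡ′ (g 0) z)) , (λ z → h (*-zeroʳ′ (f 0) z))
conv-nonzero f g (suc k) h with f 0 ℚ.* g (suc k) ℚ.≟ 0ℚ
... | no nz = 0 , suc k , refl , (λ z → nz (*-zeroˡ′ (g (suc k)) z)) , (λ z → nz (*-zeroʳ′ (f 0) z))
... | yes z with conv-nonzero (f ∘ suc) g k (λ z′ → h (cong₂ ℚ._+_ z z′))
...   | i , j , e , fi , gj = suc i , j , cong suc e , fi , gj

conv-squares : ∀ f g (N : ℕ → ℕ) n → (∀ i j → i ℕ.+ j ≡ n → f i ℚ.* g j ≡ ι (+ (N i ℕ.* N i))) →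
               conv f g n ≡ ι (+ sumSq N n)
conv-squares f g N zero    h = h 0 0 refl
conv-squares f g N (suc n) h = trans
  (cong₂ ℚ._+_ (h 0 (suc n) refl) (conv-squares (f ∘ suc) g (N ∘ suc) n (λ i j e → h (suc i) j (cong suc e))))
  (sym (ι-+ (+ (N 0 ℕ.* N 0)) (+ sumSq (N ∘ suc) n)))

coeff-mono-⊗ : ∀ a k p i → coeff (mono a k ⊗ p) (k ℕ.+ i) ≡ a ℚ.* coeff p i
coeff-mono-⊗ a zero    p i = trans (at (≈-trans (⊕-cong (≈-refl {scale a p}) 0∷[]) (⊕-identityʳ (scale a p))) i) (coeff-scale a p i)
coeff-mono-⊗ a (suc k) p i = trans (at (0∷-⊗ (mono a k) p) (suc (k ℕ.+ i))) (coeff-mono-⊗ a k p i)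

coeff-mono-⊗-< : ∀ a k p i → i ℕ.< k → coeff (mono a k ⊗ p) i ≡ 0ℚ
coeff-mono-⊗-< a (suc k) p zero    i<k       = at (0∷-⊗ (mono a k) p) 0
coeff-mono-⊗-< a (suc k) p (suc i) (s≤s i<k) = trans (at (0∷-⊗ (mono a k) p) (suc i)) (coeff-mono-⊗-< a k p i i<k)

square-abs : ∀ z → z ℤ.* z ≡ + (ℤ.∣ z ∣ ℕ.* ℤ.∣ z ∣)
square-abs (+ n)    = sym (ℤₚ.pos-* n n)
square-abs -[1+ n ] = refl

-1ℚ : ℚ
-1ℚ = ℚ.- 1ℚ

opposite-unit : ∀ {a b} → a ℚ.* b ≡ -1ℚ → b ℚ.* b ≡ 1ℚ → a ≡ b ℚ.* -1ℚ
opposite-unit {a} {b} ab bb = begin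
  a                  ≡⟨ ℚₚ.*-identityʳ a ⟨
  a ℚ.* 1ℚ           ≡⟨ cong (a ℚ.*_) bb ⟨
  a ℚ.* (b ℚ.* b)    ≡⟨ ℚₚ.*-assoc a b b ⟨
  a ℚ.* b ℚ.* b      ≡⟨ cong (ℚ._* b) ab ⟩
  -1ℚ ℚ.* b          ≡⟨ ℚₚ.*-comm -1ℚ b ⟩
  b ℚ.* -1ℚ          ∎
  where open ≡.≡-Reasoning

-- The trinomial, its reversal and their common divisor

module Ljunggren {n m : ℕ} (0<m : 0 ℕ.< m) (m+m<n : m ℕ.+ m ℕ.< n) where
  f : Poly
  f = trinomial n m

  m<n : m ℕ.< n
  m<n = ℕₚ.≤-<-trans (ℕₚ.m≤m+n m m) m+m<n

  0<n : 0 ℕ.< n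
  0<n = ℕₚ.<-trans 0<m m<n

  n-m : ℕ
  n-m = n ℕ.∸ m

  m+[n-m]≡n : m ℕ.+ n-m ≡ n
  m+[n-m]≡n = ℕₚ.m+[n∸m]≡n (ℕₚ.<⇒≤ m<n)

  n-m+m≡n : n-m ℕ.+ m ≡ n
  n-m+m≡n = ℕₚ.m∸n+n≡m (ℕₚ.<⇒≤ m<n)

  -- The form in which n > 2m is used: the inner exponent m of f lies strictly below the inner
  -- exponent n - m of f*, so f* has no term of degree m.
  m<n-m : m ℕ.< n-m
  m<n-m = ℕₚ.+-cancelˡ-< m m n-m (subst (m ℕ.+ m ℕ.<_) (sym m+[n-m]≡n) m+m<n)

  n-m<n : n-m ℕ.< n
  n-m<n = subst (n-m ℕ.<_) n-m+m≡n (ℕₚ.m<m+n n-m 0<m)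

  coeff-f : ∀ k → coeff f k ≡ coeff (mono 1ℚ n) k ℚ.+ coeff (mono -1ℚ m) k ℚ.+ coeff (mono -1ℚ 0) k
  coeff-f k = trans (coeff-⊕ (mono 1ℚ n ⊕ mono -1ℚ m) (mono -1ℚ 0) k)
    (cong (ℚ._+ coeff (mono -1ℚ 0) k) (coeff-⊕ (mono 1ℚ n) (mono -1ℚ m) k))

  sum₃ : ∀ k {a b c} → coeff (mono 1ℚ n) k ≡ a → coeff (mono -1ℚ m) k ≡ b → coeff (mono -1ℚ 0) k ≡ c →
         coeff f k ≡ a ℚ.+ b ℚ.+ c
  sum₃ k ea eb ec = trans (coeff-f k) (cong₂ ℚ._+_ (cong₂ ℚ._+_ ea eb) ec)

  f₀ : coeff f 0 ≡ -1ℚ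
  f₀ = sum₃ 0 (coeff-mono-≢ 1ℚ n 0 (ℕₚ.<⇒≢ 0<n)) (coeff-mono-≢ -1ℚ m 0 (ℕₚ.<⇒≢ 0<m)) refl

  fₘ : coeff f m ≡ -1ℚ
  fₘ = sum₃ m (coeff-mono-≢ 1ℚ n m (ℕₚ.<⇒≢ m<n)) (coeff-mono-≡ -1ℚ m) (coeff-mono-≢ -1ℚ 0 m (ℕₚ.>⇒≢ 0<m))

  fₙ : coeff f n ≡ 1ℚ
  fₙ = sum₃ n (coeff-mono-≡ 1ℚ n) (coeff-mono-≢ -1ℚ m n (ℕₚ.>⇒≢ m<n)) (coeff-mono-≢ -1ℚ 0 n (ℕₚ.>⇒≢ 0<n))

  f-else : ∀ {k} → k ≢ 0 → k ≢ m → k ≢ n → coeff f k ≡ 0ℚ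
  f-else {k} k≢0 k≢m k≢n = sum₃ k (coeff-mono-≢ 1ℚ n k k≢n) (coeff-mono-≢ -1ℚ m k k≢m) (coeff-mono-≢ -1ℚ 0 k k≢0)

  deg-f : Deg≤ n f
  deg-f k n<k = f-else (ℕₚ.>⇒≢ (ℕₚ.<-trans 0<n n<k)) (ℕₚ.>⇒≢ (ℕₚ.<-trans m<n n<k)) (ℕₚ.>⇒≢ n<k)

  f-integral : Coeffs Integral f
  f-integral k with k ℕ.≟ 0 | k ℕ.≟ m | k ℕ.≟ n
  ... | yes refl | _        | _        = -[1+ 0 ] , trans f₀ (sym ι-[-1])
  ... | no _     | yes refl | _        = -[1+ 0 ] , trans fₘ (sym ι-[-1])
  ... | no _     | no _     | yes refl = + 1 , trans fₙ (sym ι-1)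
  ... | no k≢0   | no k≢m   | no k≢n   = +0 , trans (f-else k≢0 k≢m k≢n) (sym ι-0)

  f* : Poly
  f* = rev n f

  f*₀ : coeff f* 0 ≡ 1ℚ
  f*₀ = trans (coeff-rev n f 0 n refl) fₙ

  f*ₙ : coeff f* n ≡ -1ℚ
  f*ₙ = trans (coeff-rev n f n 0 (ℕₚ.+-identityʳ n)) f₀

  f*ₙ₋ₘ : coeff f* n-m ≡ -1ℚ
  f*ₙ₋ₘ = trans (coeff-rev n f n-m m n-m+m≡n) fₘ

  f*ₘ : coeff f* m ≡ 0ℚ
  f*ₘ = trans (coeff-rev n f m n-m m+[n-m]≡n) (f-else (ℕₚ.>⇒≢ (ℕₚ.<-trans 0<m m<n-m)) (ℕₚ.>⇒≢ m<n-m) (ℕₚ.<⇒≢ n-m<n))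

  coeff-f⊗ : ∀ p k {a b c} → coeff (mono 1ℚ n ⊗ p) k ≡ a →
             coeff (mono -1ℚ m ⊗ p) k ≡ b → coeff (mono -1ℚ 0 ⊗ p) k ≡ c →
             coeff (f ⊗ p) k ≡ a ℚ.+ b ℚ.+ c
  coeff-f⊗ p k {a} {b} {c} ea eb ec = begin
    coeff (f ⊗ p) k
      ≡⟨ at (⊗-distribʳ p (mono 1ℚ n ⊕ mono -1ℚ m) (mono -1ℚ 0)) k ⟩
    coeff ((mono 1ℚ n ⊕ mono -1ℚ m) ⊗ p ⊕ mono -1ℚ 0 ⊗ p) k
      ≡⟨ at (⊕-cong (⊗-distribʳ p (mono 1ℚ n) (mono -1ℚ m)) (≈-refl {mono -1ℚ 0 ⊗ p})) k ⟩
    coeff (mono 1ℚ n ⊗ p ⊕ mono -1ℚ m ⊗ p ⊕ mono -1ℚ 0 ⊗ p) k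
      ≡⟨ coeff-⊕ (mono 1ℚ n ⊗ p ⊕ mono -1ℚ m ⊗ p) (mono -1ℚ 0 ⊗ p) k ⟩
    coeff (mono 1ℚ n ⊗ p ⊕ mono -1ℚ m ⊗ p) k ℚ.+ coeff (mono -1ℚ 0 ⊗ p) k
      ≡⟨ cong (ℚ._+ coeff (mono -1ℚ 0 ⊗ p) k) (coeff-⊕ (mono 1ℚ n ⊗ p) (mono -1ℚ m ⊗ p) k) ⟩
    coeff (mono 1ℚ n ⊗ p) k ℚ.+ coeff (mono -1ℚ m ⊗ p) k ℚ.+ coeff (mono -1ℚ 0 ⊗ p) k
      ≡⟨ cong₂ ℚ._+_ (cong₂ ℚ._+_ ea eb) ec ⟩
    a ℚ.+ b ℚ.+ c                                                  ∎
    where open ≡.≡-Reasoning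

  ff*₀ : coeff (f ⊗ f*) 0 ≡ -1ℚ
  ff*₀ = coeff-f⊗ f* 0 (coeff-mono-⊗-< 1ℚ n f* 0 0<n) (coeff-mono-⊗-< -1ℚ m f* 0 0<m)
           (trans (coeff-mono-⊗ -1ℚ 0 f* 0) (cong (-1ℚ ℚ.*_) f*₀))

  -- The only contribution is that of -x^m times the constant coefficient 1 of f*.
  ff*ₘ : coeff (f ⊗ f*) m ≡ -1ℚ
  ff*ₘ = coeff-f⊗ f* m (coeff-mono-⊗-< 1ℚ n f* m m<n)
           (trans (cong (coeff (mono -1ℚ m ⊗ f*)) (sym (ℕₚ.+-identityʳ m))) (trans (coeff-mono-⊗ -1ℚ m f* 0) (cong (-1ℚ ℚ.*_) f*₀)))
           (trans (coeff-mono-⊗ -1ℚ 0 f* m) (cong (-1ℚ ℚ.*_) f*ₘ))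

  ff*ₙ : coeff (f ⊗ f*) n ≡ 1ℚ ℚ.+ 1ℚ ℚ.+ 1ℚ
  ff*ₙ = coeff-f⊗ f* n
           (trans (cong (coeff (mono 1ℚ n ⊗ f*)) (sym (ℕₚ.+-identityʳ n))) (trans (coeff-mono-⊗ 1ℚ n f* 0) (cong (1ℚ ℚ.*_) f*₀)))
           (trans (cong (coeff (mono -1ℚ m ⊗ f*)) (sym m+[n-m]≡n)) (trans (coeff-mono-⊗ -1ℚ m f* n-m) (cong (-1ℚ ℚ.*_) f*ₙ₋ₘ)))
           (trans (coeff-mono-⊗ -1ℚ 0 f* n) (cong (-1ℚ ℚ.*_) f*ₙ))

  -- Integrality makes the norm rigid: over ℤ it determines F up to sign and reversal, as
  -- `same-norm` shows. `N` holds the absolute values of the coefficients.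
  record SameNorm (F : Poly) : Set where
    field
      deg      : Deg≤ n F
      integral : Coeffs Integral F
      norm     : F ⊗ rev n F ≈ f ⊗ f*

    F* : Poly
    F* = rev n F

    N : ℕ → ℕ
    N k = ℤ.∣ proj₁ (integral k) ∣

    N≡0⇒F≡0 : ∀ {k} → N k ≡ 0 → coeff F k ≡ 0ℚ
    N≡0⇒F≡0 {k} e = trans (proj₂ (integral k)) (trans (cong ι (ℤₚ.∣i∣≡0⇒i≡0 e)) ι-0)

    F≢0⇒N≢0 : ∀ {k} → coeff F k ≢ 0ℚ → N k ≢ 0
    F≢0⇒N≢0 h e = h (N≡0⇒F≡0 e)

    F-square : ∀ k → coeff F k ℚ.* coeff F k ≡ ι (+ (N k ℕ.* N k))
    F-square k = let (z , e) = integral k in trans (cong₂ ℚ._*_ e e) (trans (sym (ι-* z z)) (cong ι (square-abs z)))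

    sumSq≡3 : sumSq N n ≡ 3
    sumSq≡3 = ℤₚ.+-injective (ι-injective (begin
      ι (+ sumSq N n)                 ≡⟨ conv-squares (coeff F) (coeff F*) N n (λ i j e →
                                           trans (cong (coeff F i ℚ.*_) (coeff-rev n F j i (trans (ℕₚ.+-comm j i) e))) (F-square i)) ⟨
      conv (coeff F) (coeff F*) n     ≡⟨ coeff-⊗ F F* n ⟨
      coeff (F ⊗ F*) n                ≡⟨ at norm n ⟩
      coeff (f ⊗ f*) n                ≡⟨ trans ff*ₙ (sym ι-3) ⟩
      ι (+ 3)                         ∎))
      where open ≡.≡-Reasoning

    F₀Fₙ : coeff F 0 ℚ.* coeff F n ≡ -1ℚ
    F₀Fₙ = begin
      coeff F 0 ℚ.* coeff F n         ≡⟨ cong (coeff F 0 ℚ.*_) (coeff-rev n F 0 n refl) ⟨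
      coeff F 0 ℚ.* coeff F* 0        ≡⟨ coeff-⊗ F F* 0 ⟨
      coeff (F ⊗ F*) 0                ≡⟨ at norm 0 ⟩
      coeff (f ⊗ f*) 0                ≡⟨ ff*₀ ⟩
      -1ℚ                             ∎
      where open ≡.≡-Reasoning

    N₀Nₙ : N 0 ℕ.* N n ≡ 1
    N₀Nₙ = let (z , e) = integral 0 ; (w , e′) = integral n in
      trans (sym (ℤₚ.abs-* z w)) (cong ℤ.∣_∣ (ι-injective {z ℤ.* w} { -[1+ 0 ] } (trans (ι-* z w) (trans (sym (cong₂ ℚ._*_ e e′)) (trans F₀Fₙ (sym ι-[-1]))))))

    N₀≡1 : N 0 ≡ 1
    N₀≡1 = ℕₚ.m*n≡1⇒m≡1 (N 0) (N n) N₀Nₙ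

    Nₙ≡1 : N n ≡ 1
    Nₙ≡1 = ℕₚ.m*n≡1⇒n≡1 (N 0) (N n) N₀Nₙ

    -- Positions 0 and n are occupied because F₀ Fₙ = -1, so a single inner position uses up the sum
    -- of squares 3.
    support : ∀ {k} → 0 ℕ.< k → k ℕ.< n → coeff F k ≢ 0ℚ →
              ∀ {i} → i ≢ 0 → i ≢ k → i ≢ n → coeff F i ≡ 0ℚ
    support {k} 0<k k<n Fk≢0 {i} i≢0 i≢k i≢n with i ℕ.≤? n
    ... | no i≰n  = deg i (ℕₚ.≰⇒> i≰n)
    ... | yes i≤n = N≡0⇒F≡0 (three-in-support N sumSq≡3 z≤n (ℕₚ.<⇒≤ k<n) ℕₚ.≤-refl
        (ℕₚ.<⇒≢ 0<k) (ℕₚ.<⇒≢ 0<n) (ℕₚ.<⇒≢ k<n)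
        (λ e → ℕₚ.1+n≢0 (trans (sym N₀≡1) e)) (F≢0⇒N≢0 Fk≢0) (λ e → ℕₚ.1+n≢0 (trans (sym Nₙ≡1) e))
        i≤n i≢0 i≢k i≢n)

    conv-m : conv (coeff F) (coeff F*) m ≡ -1ℚ
    conv-m = trans (sym (coeff-⊗ F F* m)) (trans (at norm m) ff*ₘ)

    -- Otherwise some Fᵢ Fₙ₋ⱼ ≠ 0 with i + j = m and i, j > 0, and 0 < i < n - j < n are four indices in the support.
    m-in-support : (coeff F m ≢ 0ℚ) ⊎ (coeff F* m ≢ 0ℚ)
    m-in-support = split (conv-nonzero (coeff F) (coeff F*) m (λ e → -1≢0 (trans (sym conv-m) e)))
      where
      -1≢0 : -1ℚ ≢ 0ℚ
      -1≢0 ()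
      split : (∃ λ i → ∃ λ j → (i ℕ.+ j ≡ m) × (coeff F i ≢ 0ℚ) × (coeff F* j ≢ 0ℚ)) →
              (coeff F m ≢ 0ℚ) ⊎ (coeff F* m ≢ 0ℚ)
      split (zero , j , refl , _ , Fj) = inj₂ Fj
      split (suc i , zero , e , Fi , _) = inj₁ (subst (λ k → coeff F k ≢ 0ℚ) (trans (sym (ℕₚ.+-identityʳ (suc i))) e) Fi)
      split (suc i , suc j , e , Fi , Fj) = ⊥-elim (Fj (trans (coeff-rev n F (suc j) j′ j+j′≡n)
          (support (s≤s z≤n) i<n Fi (ℕₚ.>⇒≢ (ℕₚ.≤-<-trans z≤n i<j′)) (ℕₚ.>⇒≢ i<j′) (ℕₚ.<⇒≢ j′<n))))
        where
        j′ = n ℕ.∸ suc j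
        i<n : suc i ℕ.< n
        i<n = ℕₚ.≤-<-trans (subst (suc i ℕ.≤_) e (ℕₚ.m≤m+n (suc i) (suc j))) m<n
        j<n : suc j ℕ.< n
        j<n = ℕₚ.≤-<-trans (subst (suc j ℕ.≤_) e (ℕₚ.m≤n+m (suc j) (suc i))) m<n
        j+j′≡n : suc j ℕ.+ j′ ≡ n
        j+j′≡n = ℕₚ.m+[n∸m]≡n (ℕₚ.<⇒≤ j<n)
        i<j′ : suc i ℕ.< j′
        i<j′ = ℕₚ.+-cancelˡ-< (suc j) (suc i) j′ (subst (suc j ℕ.+ suc i ℕ.<_) (sym j+j′≡n)
                 (subst (ℕ._< n) (trans (sym e) (ℕₚ.+-comm (suc i) (suc j))) m<n))
        j′<n : j′ ℕ.< n
        j′<n = subst (j′ ℕ.<_) j+j′≡n (ℕₚ.m<n+m j′ (s≤s z≤n))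

    -- The support is {0, m, n}, and the m-th coefficient of F F* reduces to Fₘ Fₙ = -1. Together
    -- with F₀ Fₙ = -1 and Fₙ² = 1 this gives F₀ = Fₘ = -Fₙ.
    multiple-of-f : coeff F m ≢ 0ℚ → F ≈ scale (coeff F n) f
    multiple-of-f Fm≢0 = mk go
      where
      others : ∀ {i} → i ≢ 0 → i ≢ m → i ≢ n → coeff F i ≡ 0ℚ
      others = support 0<m m<n Fm≢0

      -- For i = 0 the second factor is F*ₘ = Fₙ₋ₘ, zero since n - m lies strictly between m and n.
      -- For any other index `i` that differs from m, Fᵢ is itself outside the support.
      off : ∀ i j → i ℕ.+ j ≡ m ℕ.+ 0 → i ≢ m → coeff F i ℚ.* coeff F* j ≡ 0ℚ
      off zero    j e i≢m = *-zeroʳ′ (coeff F 0) (trans (cong (coeff F*) (trans e (ℕₚ.+-identityʳ m)))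
        (trans (coeff-rev n F m n-m m+[n-m]≡n) (others (ℕₚ.>⇒≢ (ℕₚ.<-trans 0<m m<n-m)) (ℕₚ.>⇒≢ m<n-m) (ℕₚ.<⇒≢ n-m<n))))
      off (suc i) j e i≢m = *-zeroˡ′ (coeff F* j) (others (λ ()) i≢m
        (ℕₚ.<⇒≢ (ℕₚ.≤-<-trans (subst (suc i ℕ.≤_) (trans e (ℕₚ.+-identityʳ m)) (ℕₚ.m≤m+n (suc i) j)) m<n)))

      FₘFₙ : coeff F m ℚ.* coeff F n ≡ -1ℚ
      FₘFₙ = begin
        coeff F m ℚ.* coeff F n               ≡⟨ cong (coeff F m ℚ.*_) (coeff-rev n F 0 n refl) ⟨
        coeff F m ℚ.* coeff F* 0              ≡⟨ conv-single (coeff F) (coeff F*) m 0 off ⟨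
        conv (coeff F) (coeff F*) (m ℕ.+ 0)   ≡⟨ cong (conv (coeff F) (coeff F*)) (ℕₚ.+-identityʳ m) ⟩
        conv (coeff F) (coeff F*) m           ≡⟨ conv-m ⟩
        -1ℚ                                   ∎
        where open ≡.≡-Reasoning

      FₙFₙ : coeff F n ℚ.* coeff F n ≡ 1ℚ
      FₙFₙ = trans (F-square n) (trans (cong (λ k → ι (+ (k ℕ.* k))) Nₙ≡1) ι-1)

      at-k : ∀ k {c} → coeff f k ≡ c → coeff F k ≡ coeff F n ℚ.* c → coeff F k ≡ coeff (scale (coeff F n) f) k
      at-k k e h = trans h (sym (trans (coeff-scale (coeff F n) f k) (cong (coeff F n ℚ.*_) e)))

      go : F ≈ₚ scale (coeff F n) f
      go k with k ℕ.≟ 0 | k ℕ.≟ m | k ℕ.≟ n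
      ... | yes refl | _        | _        = at-k 0 f₀ (opposite-unit F₀Fₙ FₙFₙ)
      ... | no _     | yes refl | _        = at-k m fₘ (opposite-unit FₘFₙ FₙFₙ)
      ... | no _     | no _     | yes refl = at-k n fₙ (sym (ℚₚ.*-identityʳ (coeff F n)))
      ... | no k≢0   | no k≢m   | no k≢n   = at-k k (f-else k≢0 k≢m k≢n) (trans (others k≢0 k≢m k≢n) (sym (ℚₚ.*-zeroʳ (coeff F n))))

    leading≢0 : coeff F n ≢ 0ℚ
    leading≢0 e = ℕₚ.1+n≢0 (trans (sym Nₙ≡1) (cong ℤ.∣_∣ (ι-injective (trans (sym (proj₂ (integral n))) (trans e (sym ι-0))))))

  integral-rev : ∀ t p → Coeffs Integral p → Coeffs Integral (rev t p)
  integral-rev t p ip k with k ℕ.≤? t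
  ... | yes k≤t = subst Integral (sym (coeff-rev t p k (t ℕ.∸ k) (ℕₚ.m+[n∸m]≡n k≤t))) (ip (t ℕ.∸ k))
  ... | no k≰t  = +0 , trans (deg-rev t p k (ℕₚ.≰⇒> k≰t)) (sym ι-0)

  rev-same-norm : ∀ {F} → SameNorm F → SameNorm (rev n F)
  rev-same-norm {F} s = record
    { deg      = deg-rev n F
    ; integral = integral-rev n F integral
    ; norm     = ≈-trans (⊗-congʳ (rev n F) (rev-rev n F deg)) (≈-trans (⊗-comm (rev n F) F) norm) }
    where open SameNorm s

  -- If m lies in the support of F* instead, the same argument is run for F*, whose norm agrees
  -- because F** = F.
  same-norm : ∀ {F} → SameNorm F → ∃ λ c → (c ≢ 0ℚ) × ((F ≈ scale c f) ⊎ (rev n F ≈ scale c f))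
  same-norm {F} s = split m-in-support
    where
    open SameNorm s
    s* = rev-same-norm s
    split : (coeff F m ≢ 0ℚ) ⊎ (coeff F* m ≢ 0ℚ) → ∃ λ c → (c ≢ 0ℚ) × ((F ≈ scale c f) ⊎ (F* ≈ scale c f))
    split (inj₁ Fₘ≢0)  = coeff F n , leading≢0 , inj₁ (multiple-of-f Fₘ≢0)
    split (inj₂ F*ₘ≢0) = coeff F* n , SameNorm.leading≢0 s* , inj₂ (SameNorm.multiple-of-f s* F*ₘ≢0)

  integral-⊗ : ∀ p q → Coeffs Integral p → Coeffs Integral q → Coeffs Integral (p ⊗ q)
  integral-⊗ p q ip iq k = subst Integral (sym (coeff-⊗ p q k)) (go (coeff p) k ip)
    where
    go : ∀ a k → (∀ i → Integral (a i)) → Integral (conv a (coeff q) k)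
    go a zero    ia = integral-* (ia 0) (iq 0)
    go a (suc k) ia = integral-+ (integral-* (ia 0) (iq (suc k))) (go (a ∘ suc) k (ia ∘ suc))

  ∣ₚ-unscale : ∀ u q {p c} → c ≢ 0ℚ → u ⊗ q ≈ scale c p → u ∣ₚ p
  ∣ₚ-unscale u q {p} {c} c≢0 e with inverse c≢0
  ... | r , _ , rc≡1 = scale r q , at (begin
    u ⊗ scale r q          ≈⟨ ⊗-scale r u q ⟩
    scale r (u ⊗ q)        ≈⟨ scale-cong refl e ⟩
    scale r (scale c p)    ≈⟨ scale-* r c p ⟩
    scale (r ℚ.* c) p      ≈⟨ scale-cong rc≡1 (≈-refl {p}) ⟩
    scale 1ℚ p             ≈⟨ scale-one p ⟩
    p                      ∎)
    where open PolyReasoning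

  CommonDivisor : Set
  CommonDivisor = ∃ λ u → NonConstant u × u ∣ₚ f × u ∣ₚ f*

  -- F = g h* and F* = g* h. If F is a multiple of f, then g* h is one of f*, and h divides f and
  -- f*. If F* is a multiple of f, then g h* is one of f*, and g divides both.
  common-divisor′ : ∀ {s t} → (F : IntegralFactors f) → let open IntegralFactors F in
    coeff g s ≢ 0ℚ → Deg≤ s g → coeff h t ≢ 0ℚ → Deg≤ t h → CommonDivisor
  common-divisor′ {s} {t} (factors g h ig ih ng nh gh≈f) gs≢0 dg ht≢0 dh = result (same-norm sn)
    where
    top≢0 : coeff f (s ℕ.+ t) ≢ 0ℚ
    top≢0 e = nonzero-product gs≢0 ht≢0 (trans (sym (coeff-⊗-top g h dg dh)) (trans (at gh≈f (s ℕ.+ t)) e))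

    -- Reversal is multiplicative only when the reversal degrees add up, so the exact degrees of the
    -- factors are needed.
    s+t≡n : s ℕ.+ t ≡ n
    s+t≡n = ℕₚ.≤-antisym (ℕₚ.≮⇒≥ (λ l → top≢0 (deg-f _ l)))
                         (ℕₚ.≮⇒≥ (λ l → fₙ≢0 (trans (sym (at gh≈f n)) (deg-⊗ g h dg dh n l))))
      where
      fₙ≢0 : coeff f n ≢ 0ℚ
      fₙ≢0 e with trans (sym fₙ) e
      ... | ()

    g* = rev s g
    h* = rev t h
    F  = g ⊗ h*

    revF : rev n F ≈ g* ⊗ h
    revF = begin
      rev n F                 ≡⟨ cong (λ k → rev k F) s+t≡n ⟨
      rev (s ℕ.+ t) F         ≈⟨ rev-⊗ s t g h* dg (deg-rev t h) ⟩
      g* ⊗ rev t h*           ≈⟨ ⊗-congʳ g* (rev-rev t h dh) ⟩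
      g* ⊗ h                  ∎
      where open PolyReasoning

    f*≈ : f* ≈ g* ⊗ h*
    f*≈ = begin
      rev n f                 ≈⟨ rev-cong n gh≈f ⟨
      rev n (g ⊗ h)           ≡⟨ cong (λ k → rev k (g ⊗ h)) s+t≡n ⟨
      rev (s ℕ.+ t) (g ⊗ h)   ≈⟨ rev-⊗ s t g h dg dh ⟩
      g* ⊗ h*                 ∎
      where open PolyReasoning

    sn : SameNorm F
    sn = record
      { deg = subst (λ k → Deg≤ k F) s+t≡n (deg-⊗ g h* dg (deg-rev t h))
      ; integral = integral-⊗ g h* ig (integral-rev t h ih)
      ; norm = begin
          F ⊗ rev n F                  ≈⟨ ⊗-congʳ F revF ⟩
          (g ⊗ h*) ⊗ (g* ⊗ h)
            ≈⟨ solve 4 (λ g h* g* h → g :* h* :* (g* :* h) := g :* h :* (g* :* h*)) ≈-refl g h* g* h ⟩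
          (g ⊗ h) ⊗ (g* ⊗ h*)          ≈⟨ ⊗-cong gh≈f (≈-sym f*≈) ⟩
          f ⊗ f*                       ∎ }
      where
      open PolyReasoning
      open PolySolver

    result : (∃ λ c → (c ≢ 0ℚ) × ((F ≈ scale c f) ⊎ (rev n F ≈ scale c f))) → CommonDivisor
    result (c , c≢0 , inj₁ F≈cf) = h , nh , (g , at (≈-trans (⊗-comm h g) gh≈f)) ,
      ∣ₚ-unscale h g* c≢0 (≈-trans (⊗-comm h g*) (≈-trans (≈-sym revF) (≈-trans (rev-cong n F≈cf) (rev-scale n c f))))
    result (c , c≢0 , inj₂ F*≈cf) = g , ng , (h , at gh≈f) ,
      ∣ₚ-unscale g h* c≢0 (≈-trans (≈-sym (rev-rev n F (SameNorm.deg sn))) (≈-trans (rev-cong n F*≈cf) (rev-scale n c f)))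

  common-divisor : Reducible f → CommonDivisor
  common-divisor red = go (integral-factors f-integral red)
    where
    go : IntegralFactors f → CommonDivisor
    go F = let open IntegralFactors F
               (_ , _ , gs≢0 , dg) = nonconstant-degree {g} g-nonconstant
               (_ , _ , ht≢0 , dh) = nonconstant-degree {h} h-nonconstant
           in common-divisor′ F gs≢0 dg ht≢0 dh

-- Valuations and greatest common divisors

prime-∤-^ : ∀ {r} → Prime r → ∀ {s} → ¬ (r ∣ s) → ∀ v → ¬ (r ∣ s ℕ.^ v)
prime-∤-^ pr r∤s zero    r∣1 = ¬prime[1] (subst Prime (∣1⇒≡1 r∣1) pr)
prime-∤-^ pr {s} r∤s (suc v) r∣ with euclidsLemma s (s ℕ.^ v) pr r∣
... | inj₁ r∣s  = r∤s r∣s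
... | inj₂ r∣sᵛ = prime-∤-^ pr r∤s v r∣sᵛ

prime-∤-* : ∀ {r s t} → Prime r → ¬ (r ∣ s) → ¬ (r ∣ t) → ¬ (r ∣ s ℕ.* t)
prime-∤-* {s = s} {t} pr r∤s r∤t r∣st = Sum.[ r∤s , r∤t ] (euclidsLemma s t pr r∣st)

coprime⇒∤ : ∀ {r M s} → Prime r → r ∣ s → Coprime M s → ¬ (r ∣ M)
coprime⇒∤ pr r∣s c r∣M = ¬prime[1] (subst Prime (c (r∣M , r∣s)) pr)

^-∣ : ∀ r {v w} → v ℕ.≤ w → r ℕ.^ v ∣ r ℕ.^ w
^-∣ r {v} {w} v≤w = divides (r ℕ.^ (w ℕ.∸ v))
  (trans (cong (r ℕ.^_) (sym (ℕₚ.m∸n+n≡m v≤w))) (ℕₚ.^-distribˡ-+-* r (w ℕ.∸ v) v))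

-- Otherwise r^(v+1) would divide u d = r^v W, and so r would divide W.
valuation-bound : ∀ {r v w W u d} → Prime r → ¬ (r ∣ W) → w ≡ r ℕ.^ v ℕ.* W → w ≡ u ℕ.* d → r ∣ u → ¬ (r ℕ.^ v ∣ d)
valuation-bound {r} {v} {w} {W} {u} {d} pr r∤W w≡rᵛW w≡ud r∣u rᵛ∣d =
  r∤W (*-cancelʳ-∣ (r ℕ.^ v) (subst (r ℕ.* r ℕ.^ v ∣_)
    (trans (sym w≡ud) (trans w≡rᵛW (ℕₚ.*-comm (r ℕ.^ v) W))) (*-pres-∣ r∣u rᵛ∣d)))
  where
  instance
    r≢0 : ℕ.NonZero r
    r≢0 = prime⇒nonZero pr
    rᵛ≢0 : ℕ.NonZero (r ℕ.^ v)
    rᵛ≢0 = ℕₚ.m^n≢0 r v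

prime[3] : Prime 3
prime[3] = from-yes (prime? 3)

n<2^n : ∀ n → n ℕ.< 2 ℕ.^ n
n<2^n zero    = s≤s z≤n
n<2^n (suc n) = ℕₚ.+-mono-≤ (ℕₚ.≤-trans (s≤s z≤n) (n<2^n n)) (ℕₚ.≤-trans (n<2^n n) (ℕₚ.m≤m+n _ 0))

-- Each halving spends one unit of fuel, so any fuel from `p` upwards will do. The fuel r chosen by
-- `e` is enough because p < 2^p ≤ r.
e-go-2^ : ∀ fuel p o → p ℕ.≤ fuel → ¬ (2 ∣ o) → e-go fuel (2 ℕ.^ p ℕ.* o) ≡ 2 ℕ.^ p
e-go-2^ zero       zero    o _          _   = refl
e-go-2^ (suc fuel) zero    o _          2∤o with (1 ℕ.* o) % 2 ℕ.≟ 0 | 1 ℕ.* o ℕ.≟ 0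
... | yes z | no _  = ⊥-elim (2∤o (subst (2 ∣_) (ℕₚ.*-identityˡ o) (m%n≡0⇒n∣m (1 ℕ.* o) 2 z)))
... | yes _ | yes _ = refl
... | no _  | _     = refl
e-go-2^ (suc fuel) (suc p) o (s≤s p≤f) 2∤o with (2 ℕ.^ suc p ℕ.* o) % 2 ℕ.≟ 0 | 2 ℕ.^ suc p ℕ.* o ℕ.≟ 0
... | yes _ | no _  = cong (2 ℕ.*_) (trans (cong (e-go fuel) half) (e-go-2^ fuel p o p≤f 2∤o))
  where
  half : 2 ℕ.^ suc p ℕ.* o / 2 ≡ 2 ℕ.^ p ℕ.* o
  half = trans (cong (_/ 2) (trans (ℕₚ.*-assoc 2 (2 ℕ.^ p) o) (ℕₚ.*-comm 2 (2 ℕ.^ p ℕ.* o)))) (m*n/n≡m (2 ℕ.^ p ℕ.* o) 2)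
... | yes _ | yes z = ⊥-elim (2∤o (subst (2 ∣_) (sym o≡0) (divides 0 refl)))
  where
  o≡0 : o ≡ 0
  o≡0 = Sum.[ (λ z′ → ⊥-elim (ℕ.≢-nonZero⁻¹ (2 ℕ.^ suc p) {{ℕₚ.m^n≢0 2 (suc p)}} z′)) , (λ z′ → z′) ]
          (ℕₚ.m*n≡0⇒m≡0∨n≡0 (2 ℕ.^ suc p) z)
... | no nz | _     = ⊥-elim (nz (trans (cong (_% 2) (trans (ℕₚ.*-assoc 2 (2 ℕ.^ p) o) (ℕₚ.*-comm 2 (2 ℕ.^ p ℕ.* o)))) (m*n%n≡0 (2 ℕ.^ p ℕ.* o) 2)))

e-2^ : ∀ p o → ¬ (2 ∣ o) → e (2 ℕ.^ p ℕ.* o) ≡ 2 ℕ.^ p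
e-2^ p zero    2∤o = ⊥-elim (2∤o (divides 0 refl))
e-2^ p (suc o) 2∤o = e-go-2^ (2 ℕ.^ p ℕ.* suc o) p (suc o) (ℕₚ.≤-trans (ℕₚ.<⇒≤ (n<2^n p)) (ℕₚ.m≤m*n (2 ℕ.^ p) (suc o))) 2∤o

-- Meant for k = n - 2m, where gcd(n, m) is also the gcd of m and k. Hence the cofactors `m′` and
-- `k′` share no prime.
record GcdSplit (n m k : ℕ) : Set where
  field
    m′ k′   : ℕ
    m≡      : m ≡ m′ ℕ.* gcd n m
    k≡      : k ≡ k′ ℕ.* gcd n m
    common  : ∀ {r} → r ∣ m → r ∣ k → r ∣ gcd n m
    coprime : ∀ {r} → Prime r → r ∣ m′ → ¬ (r ∣ k′)

gcd-split : ∀ {n m k} → 0 ℕ.< m → n ≡ m ℕ.+ m ℕ.+ k → GcdSplit n m k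
gcd-split {n} {m} {k} 0<m n≡ with gcd[m,n]∣n n m
  | ∣m+n∣m⇒∣n (subst (gcd n m ∣_) n≡ (gcd[m,n]∣m n m)) (∣m∣n⇒∣m+n (gcd[m,n]∣n n m) (gcd[m,n]∣n n m))
... | divides m′ m≡ | divides k′ k≡ = record
  { m′ = m′ ; k′ = k′ ; m≡ = m≡ ; k≡ = k≡ ; common = common
  ; coprime = λ {r} pr r∣m′ r∣k′ → ¬prime[1] (subst Prime (∣1⇒≡1 (*-cancelʳ-∣ d
      (subst (r ℕ.* d ∣_) (sym (ℕₚ.*-identityˡ d)) (common (subst (r ℕ.* d ∣_) (sym m≡) (*-monoˡ-∣ d r∣m′))
        (subst (r ℕ.* d ∣_) (sym k≡) (*-monoˡ-∣ d r∣k′)))))) pr) }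
  where
  d = gcd n m
  instance
    d≢0 : ℕ.NonZero d
    d≢0 = ℕ.≢-nonZero (gcd[m,n]≢0 n m (inj₂ (ℕₚ.>⇒≢ 0<m)))
  common : ∀ {r} → r ∣ m → r ∣ k → r ∣ d
  common r∣m r∣k = gcd-greatest (subst (_ ∣_) (sym n≡) (∣m∣n⇒∣m+n (∣m∣n⇒∣m+n r∣m r∣m) r∣k)) r∣m

-- If w ≤ v, then r^w divides both m and k, hence their gcd; the further factor r of `k′` would then
-- put r^(w+1) into k.
valuation-< : ∀ {r n m k v w U W} (s : GcdSplit n m k) → Prime r → m ≡ r ℕ.^ v ℕ.* U → k ≡ r ℕ.^ w ℕ.* W →
              ¬ (r ∣ W) → r ∣ GcdSplit.k′ s → v ℕ.< w
valuation-< {r} {v = v} {w} {U} {W} s pr m≡ k≡ r∤W r∣k′ = ℕₚ.≰⇒> λ w≤v →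
  valuation-bound {v = w} pr r∤W k≡ (GcdSplit.k≡ s) r∣k′
    (GcdSplit.common s (subst (r ℕ.^ w ∣_) (sym m≡) (∣m⇒∣m*n U (^-∣ r w≤v))) (subst (r ℕ.^ w ∣_) (sym k≡) (m∣m*n W)))

valuation-> : ∀ {r n m k v w U W} (s : GcdSplit n m k) → Prime r → m ≡ r ℕ.^ v ℕ.* U → k ≡ r ℕ.^ w ℕ.* W →
              ¬ (r ∣ U) → r ∣ GcdSplit.m′ s → w ℕ.< v
valuation-> {r} {v = v} {w} {U} {W} s pr m≡ k≡ r∤U r∣m′ = ℕₚ.≰⇒> λ v≤w →
  valuation-bound {v = v} pr r∤U m≡ (GcdSplit.m≡ s) r∣m′
    (GcdSplit.common s (subst (r ℕ.^ v ∣_) (sym m≡) (m∣m*n U)) (subst (r ℕ.^ v ∣_) (sym k≡) (∣m⇒∣m*n W (^-∣ r v≤w))))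

open import Data.Nat using (_+_; _*_; _∸_; _<_)

-- Residues modulo a common divisor

rev-mono : ∀ a i j → rev (i + j) (mono a i) ≈ mono a j
rev-mono a i j = ≈-sym (rev-unique (i + j) (mono a i) (mono a j)
  (λ k l → coeff-mono-≢ a j k (ℕₚ.>⇒≢ (ℕₚ.≤-<-trans (ℕₚ.m≤n+m j i) l)))
  swap)
  where
  swap : ∀ i′ j′ → i′ + j′ ≡ i + j → coeff (mono a j) i′ ≡ coeff (mono a i) j′
  swap i′ j′ e with i′ ℕ.≟ j | j′ ℕ.≟ i
  ... | yes refl | yes refl = trans (coeff-mono-≡ a i′) (sym (coeff-mono-≡ a j′))
  ... | yes refl | no j′≢i  = ⊥-elim (j′≢i (ℕₚ.+-cancelˡ-≡ i′ j′ i (trans e (ℕₚ.+-comm i i′))))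
  ... | no i′≢j  | yes refl = ⊥-elim (i′≢j (ℕₚ.+-cancelʳ-≡ j′ i′ j (trans e (ℕₚ.+-comm j′ j))))
  ... | no i′≢j  | no j′≢i  = trans (coeff-mono-≢ a j i′ i′≢j) (sym (coeff-mono-≢ a i j′ j′≢i))

module Modulo (u : Poly) where
  R : CommutativeRing 0ℓ 0ℓ
  R = quotient polyRing u

  open CommutativeRing R public
    using () renaming (_≈_ to _≡ᵤ_; refl to ≡ᵤ-refl; sym to ≡ᵤ-sym; trans to ≡ᵤ-trans;
                       +-cong to ⊕-congᵤ; +-congʳ to ⊕-congʳᵤ; *-congʳ to ⊗-congʳᵤ)
  open Exp (CommutativeRing.semiring R) public using (_^_; ^-homo-*; ^-assocʳ)
  open RingLemmas R public

  ≈⇒≡ᵤ : ∀ {p q} → p ≈ q → p ≡ᵤ q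
  ≈⇒≡ᵤ = ≈⇒≈ᵤ polyRing u

  divides⇒≡0 : ∀ {p q} → u ⊗ q ≈ p → p ≡ᵤ []
  divides⇒≡0 {p} {q} e = mod q (≈-sym e)

  ≡0⇒divides : ∀ {p} → p ≡ᵤ [] → u ∣ₚ p
  ≡0⇒divides (mod q e) = q , at (≈-sym e)

  -- The power is taken in the quotient, but its multiplication is still `_⊗_`, so the equality
  -- already holds in ℚ[x].
  mono-1 : ∀ k → mono 1ℚ k ≈ x ^ k
  mono-1 zero    = ≈-refl
  mono-1 (suc k) = ≈-trans (∷-cong refl (mono-1 k)) (≈-sym (x⊗ (x ^ k)))

  mono-[-1] : ∀ k → mono -1ℚ k ≈ neg (x ^ k)
  mono-[-1] k = ≈-trans (≈-sym (scale-mono -1ℚ 1ℚ k)) (scale-cong refl (mono-1 k))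

  trinomial≈ : ∀ n m → trinomial n m ≈ x ^ n ⊕ neg (x ^ m) ⊕ neg one
  trinomial≈ n m = ⊕-cong (⊕-cong (mono-1 n) (mono-[-1] m)) (mono-[-1] 0)

  Φ₆≈ : ∀ d → Φ₆-pow d ≈ x ^ (2 * d) ⊕ neg (x ^ d) ⊕ one
  Φ₆≈ d = ⊕-cong (⊕-cong (mono-1 (2 * d)) (mono-[-1] d)) (≈-refl {one})

  rev-trinomial : ∀ m k → let n = m + m + k in
                  rev n (trinomial n m) ≈ one ⊕ neg (x ^ (m + k)) ⊕ neg (x ^ n)
  rev-trinomial m k = begin
    rev n (mono 1ℚ n ⊕ mono -1ℚ m ⊕ mono -1ℚ 0)
      ≈⟨ rev-⊕ n (mono 1ℚ n ⊕ mono -1ℚ m) (mono -1ℚ 0) ⟩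
    rev n (mono 1ℚ n ⊕ mono -1ℚ m) ⊕ rev n (mono -1ℚ 0)
      ≈⟨ ⊕-cong (rev-⊕ n (mono 1ℚ n) (mono -1ℚ m)) (≈-refl {rev n (mono -1ℚ 0)}) ⟩
    rev n (mono 1ℚ n) ⊕ rev n (mono -1ℚ m) ⊕ rev n (mono -1ℚ 0)
      ≡⟨ cong₂ (λ s t → rev s (mono 1ℚ n) ⊕ rev t (mono -1ℚ m) ⊕ rev n (mono -1ℚ 0))
           (sym (ℕₚ.+-identityʳ n)) (ℕₚ.+-assoc m m k) ⟩
    rev (n + 0) (mono 1ℚ n) ⊕ rev (m + (m + k)) (mono -1ℚ m) ⊕ rev n (mono -1ℚ 0)
      ≈⟨ ⊕-cong (⊕-cong (rev-mono 1ℚ n 0) (≈-trans (rev-mono -1ℚ m (m + k)) (mono-[-1] (m + k))))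
                (≈-trans (rev-mono -1ℚ 0 n) (mono-[-1] n)) ⟩
    one ⊕ neg (x ^ (m + k)) ⊕ neg (x ^ n) ∎
    where
    open PolyReasoning
    n = m + m + k

module _ {u : Poly} (nc : NonConstant u) (m k : ℕ) {q q*}
         (e : u ⊗ q ≈ trinomial (m + m + k) m)
         (e* : u ⊗ q* ≈ rev (m + m + k) (trinomial (m + m + k) m)) where
  open Modulo u

  private
    n = m + m + k
    X = x ^ m
    K = x ^ k

    xⁿ : x ^ n ≡ᵤ X ⊗ X ⊗ K
    xⁿ = ≡ᵤ-trans (^-homo-* x (m + m) k) (⊗-congʳᵤ (^-homo-* x m m))

    vanishes : X ⊗ X ⊗ K ≡ᵤ X ⊕ one
    vanishes = ≡ᵤ-trans (≡ᵤ-sym xⁿ) (x-y-z≈0⇒x≈y+z {x ^ n} {X} {one}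
      (≡ᵤ-trans (≈⇒≡ᵤ (≈-sym (trinomial≈ n m))) (divides⇒≡0 e)))

    vanishes* : X ⊗ K ⊕ X ⊗ X ⊗ K ≡ᵤ one
    vanishes* = ≡ᵤ-trans (⊕-congᵤ (≡ᵤ-sym (^-homo-* x m k)) (≡ᵤ-sym xⁿ))
      (≡ᵤ-sym (x-y-z≈0⇒x≈y+z {one} {x ^ (m + k)} {x ^ n}
        (≡ᵤ-trans (≈⇒≡ᵤ (≈-sym (rev-trinomial m k))) (divides⇒≡0 e*))))

    constant≢0 : ∀ c → c ≢ 0ℚ → ¬ ((c ∷ []) ≡ᵤ [])
    constant≢0 c c≢0 (mod h e) = nonconstant∤constant {u} h nc c≢0 (≈-sym e)

  -- `X ^ k′` and `K ^ m′` are one and the same power of `x`, which is the relation that `orders`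
  -- asks for.
  root-orders : ∀ m′ k′ → m * k′ ≡ k * m′ → (2 ∣ m′) × (3 ∣ k′)
  root-orders m′ k′ eq = let (K≈-1 , X-root) = common-root vanishes vanishes* in
    orders m′ k′ K≈-1 X-root
      (≡ᵤ-trans (^-assocʳ x m k′) (subst (λ j → x ^ j ≡ᵤ K ^ m′) (sym eq) (≡ᵤ-sym (^-assocʳ x k m′))))
      (constant≢0 (1ℚ ℚ.+ 1ℚ) (λ ())) (constant≢0 (1ℚ ℚ.+ 1ℚ ℚ.+ 1ℚ) (λ ()))

-- Modulo Φ₆(x^d) itself, y = x^d satisfies y² - y + 1 = 0, and `sixth-root` makes the trinomial
-- vanish.
Φ₆-divides : ∀ d m k → 2 ∣ m → ¬ (3 ∣ m) → 3 ∣ k → ¬ (2 ∣ k) →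
             Φ₆-pow d ∣ₚ trinomial (d * (m + m + k)) (d * m)
Φ₆-divides d m k 2∣m 3∤m 3∣k 2∤k = ≡0⇒divides (≡ᵤ-trans (≈⇒≡ᵤ (trinomial≈ (d * n) (d * m)))
  (x≈y+z⇒x-y-z≈0 {x ^ (d * n)} {x ^ (d * m)} {one} f-root))
  where
  open Modulo (Φ₆-pow d)
  n = m + m + k
  y = x ^ d

  y²≈ : y ⊗ y ≡ᵤ x ^ (2 * d)
  y²≈ = ≡ᵤ-trans (≡ᵤ-sym (^-homo-* x d d))
    (subst (λ j → x ^ (d + d) ≡ᵤ x ^ (d + j)) (sym (ℕₚ.+-identityʳ d)) ≡ᵤ-refl)

  Φ₆≡0 : Φ₆-pow d ≡ᵤ []
  Φ₆≡0 = divides⇒≡0 (≈-trans (⊗-comm (Φ₆-pow d) one) (⊗-identityˡ (Φ₆-pow d)))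

  y-root : y ⊗ y ⊕ one ≡ᵤ y
  y-root = ≡ᵤ-trans (⊕-congʳᵤ y²≈) (x-y+z≈0⇒x+z≈y {x ^ (2 * d)} {y} {one}
    (≡ᵤ-trans (≈⇒≡ᵤ (≈-sym (Φ₆≈ d))) Φ₆≡0))

  f-root : x ^ (d * n) ≡ᵤ x ^ (d * m) ⊕ one
  f-root = ≡ᵤ-trans (≡ᵤ-sym (^-assocʳ x d n))
    (≡ᵤ-trans (sixth-root m k y-root 2∣m 3∤m 3∣k 2∤k) (⊕-congʳᵤ (^-assocʳ x d m)))

-- From the common divisor to the three conclusions

gcd-orders : ∀ {n m k} → 0 < m → 0 < k → n ≡ m + m + k → Reducible (trinomial n m) → (s : GcdSplit n m k) →
             (2 ∣ GcdSplit.m′ s) × (3 ∣ GcdSplit.k′ s)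
gcd-orders {m = m} {k} 0<m 0<k refl red s = from (Ljunggren.common-divisor 0<m (ℕₚ.m<m+n (m + m) 0<k) red)
  where
  open GcdSplit s
  d = gcd (m + m + k) m

  -- Both sides are d m′ k′.
  swap : m * k′ ≡ k * m′
  swap = begin
    m * k′          ≡⟨ cong (_* k′) m≡ ⟩
    m′ * d * k′     ≡⟨ ℕₚ.*-assoc m′ d k′ ⟩
    m′ * (d * k′)   ≡⟨ ℕₚ.*-comm m′ (d * k′) ⟩
    d * k′ * m′     ≡⟨ cong (_* m′) (trans (ℕₚ.*-comm d k′) (sym k≡)) ⟩
    k * m′          ∎
    where open ≡.≡-Reasoning

  from : Ljunggren.CommonDivisor 0<m (ℕₚ.m<m+n (m + m) 0<k) → (2 ∣ m′) × (3 ∣ k′)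
  from (u , nc , (_ , e) , (_ , e*)) = root-orders {u} nc m k (mk e) (mk e*) m′ k′ swap

-- Since `m′` and `k′` share no prime, 2 ∣ m′ makes `k′` odd and 3 ∣ k′ makes `m′` prime to 3, as
-- `Φ₆-divides` requires.
Φ₆-gcd-divides : ∀ {n m k} → n ≡ m + m + k → (s : GcdSplit n m k) → 2 ∣ GcdSplit.m′ s → 3 ∣ GcdSplit.k′ s →
                 Φ₆-pow (gcd n m) ∣ₚ trinomial n m
Φ₆-gcd-divides {n} {m} {k} n≡ s 2∣m′ 3∣k′ = subst (Φ₆-pow d ∣ₚ_) (cong₂ trinomial dn≡ dm≡)
  (Φ₆-divides d m′ k′ 2∣m′ (λ 3∣m′ → coprime prime[3] 3∣m′ 3∣k′) 3∣k′ (coprime prime[2] 2∣m′))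
  where
  open GcdSplit s
  d = gcd n m
  dm≡ : d * m′ ≡ m
  dm≡ = trans (ℕₚ.*-comm d m′) (sym m≡)
  dn≡ : d * (m′ + m′ + k′) ≡ n
  dn≡ = begin
    d * (m′ + m′ + k′)           ≡⟨ ℕₚ.*-distribˡ-+ d (m′ + m′) k′ ⟩
    d * (m′ + m′) + d * k′       ≡⟨ cong₂ _+_ (ℕₚ.*-distribˡ-+ d m′ m′) (trans (ℕₚ.*-comm d k′) (sym k≡)) ⟩
    d * m′ + d * m′ + k          ≡⟨ cong (λ j → j + j + k) dm≡ ⟩
    m + m + k                    ≡⟨ n≡ ⟨
    n                            ∎
    where open ≡.≡-Reasoning

open import Data.Nat using (_^_)

theorem4 : (n m a b p q M N : ℕ) → 0 < m → 2 * m < n →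
    0 < M → 0 < N → Coprime M 6 → Coprime N 6 →
    m ≡ 2 ^ a * 3 ^ b * M → n ∸ 2 * m ≡ 2 ^ p * 3 ^ q * N →
    Reducible (trinomial n m) →
    (b < q) × (e (n ∸ 2 * m) < e m) × (Φ₆-pow (gcd n m) ∣ₚ trinomial n m)
theorem4 n m a b p q M N 0<m 2m<n 0<M 0<N M⊥6 N⊥6 m≡ k≡ red =
  -- The factor 3 of `k′` gives n - 2m more factors 3 than m has; below, the factor 2 of `m′` gives
  -- m more factors 2 than n - 2m has.
  valuation-< {v = b} {w = q} split prime[3] (3-part a b M m≡) (3-part p q N k≡)
    (prime-∤-* prime[3] (prime-∤-^ prime[3] 3∤2 p) 3∤N) 3∣k′ ,
  subst₂ _<_ (sym e-k) (sym e-m) (ℕₚ.^-monoʳ-< 2 (s≤s (s≤s z≤n)) 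
    (valuation-> {v = a} {w = p} split prime[2] m≡2 k≡2 2∤3ᵇM 2∣m′)) ,
  Φ₆-gcd-divides n≡ split 2∣m′ 3∣k′
  where
  n≡ : n ≡ m + m + (n ∸ 2 * m)
  n≡ = trans (sym (ℕₚ.m+[n∸m]≡n (ℕₚ.<⇒≤ 2m<n))) (cong (λ j → m + j + (n ∸ 2 * m)) (ℕₚ.+-identityʳ m))

  split : GcdSplit n m (n ∸ 2 * m)
  split = gcd-split 0<m n≡

  2∣m′×3∣k′ : (2 ∣ GcdSplit.m′ split) × (3 ∣ GcdSplit.k′ split)
  2∣m′×3∣k′ = gcd-orders 0<m (ℕₚ.m<n⇒0<n∸m 2m<n) n≡ red split
  2∣m′ = proj₁ 2∣m′×3∣k′
  3∣k′ = proj₂ 2∣m′×3∣k′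

  3∤2 : ¬ (3 ∣ 2)
  3∤2 = from-no (3 ∣? 2)
  2∤3 : ¬ (2 ∣ 3)
  2∤3 = from-no (2 ∣? 3)
  3∤N : ¬ (3 ∣ N)
  3∤N = coprime⇒∤ prime[3] (divides 2 refl) N⊥6

  2∤3ᵇM : ¬ (2 ∣ 3 ^ b * M)
  2∤3ᵇM = prime-∤-* prime[2] (prime-∤-^ prime[2] 2∤3 b) (coprime⇒∤ prime[2] (divides 3 refl) M⊥6)
  2∤3^qN : ¬ (2 ∣ 3 ^ q * N)
  2∤3^qN = prime-∤-* prime[2] (prime-∤-^ prime[2] 2∤3 q) (coprime⇒∤ prime[2] (divides 3 refl) N⊥6)

  m≡2 : m ≡ 2 ^ a * (3 ^ b * M)
  m≡2 = trans m≡ (ℕₚ.*-assoc (2 ^ a) (3 ^ b) M)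
  k≡2 : n ∸ 2 * m ≡ 2 ^ p * (3 ^ q * N)
  k≡2 = trans k≡ (ℕₚ.*-assoc (2 ^ p) (3 ^ q) N)

  3-part : ∀ {w} i j W → w ≡ 2 ^ i * 3 ^ j * W → w ≡ 3 ^ j * (2 ^ i * W)
  3-part i j W w≡ = trans w≡ (trans (cong (_* W) (ℕₚ.*-comm (2 ^ i) (3 ^ j))) (ℕₚ.*-assoc (3 ^ j) (2 ^ i) W))

  e-m : e m ≡ 2 ^ a
  e-m = trans (cong e m≡2) (e-2^ a (3 ^ b * M) 2∤3ᵇM)
  e-k : e (n ∸ 2 * m) ≡ 2 ^ p
  e-k = trans (cong e k≡2) (e-2^ p (3 ^ q * N) 2∤3^qN)
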